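{- For every $n>0$, the $F$-triangle $F_n(x,y)$ and the $H$-triangle $H_n(x,y)$ associated with the Hochschild lattice $\mathrm{Hoch}(n)$ are given by $$F_n(x,y)=(x+y+1)^{n-2}\Bigl(nx^2+2xy+(n+1)x+(y+1)^2\Bigr),$$ $$H_n(x,y)=(xy+1)^{n-2}\Bigl((xy+1)^2+(n-1)x\Bigr),$$ as identities of rational functions in $x,y$.
   Context: Hochschild lattice. For $n\geq 1$, a triword of length $n$ is a tuple $u=(u_1,\ldots,u_n)$ such that (T1) $u_i\in\{0,1,2\}$ for all $i$; (T2) $u_1\neq 2$; (T3) if $u_i=0$, then $u_j\neq 1$ for all $j>i$. Let $\mathrm{Tri}(n)$ be the set of all triwords of length $n$. The Hochschild lattice is $\mathrm{Hoch}(n)=(\mathrm{Tri}(n),\leq)$ where $\leq$ is the componentwise order. It is known to be a semidistributive lattice: the join is the componentwise maximum, and the meet is obtained by taking the componentwise minimum and then replacing by $0$ every entry $1$ that has an entry $0$ somewhere to its left. Core label order. Let $L$ be a finite semidistributive lattice. For a cover relation $a\lessdot b$ put $\lambda(a,b)=\min\{c\in L\mid a\vee c=b\}$; this minimum exists and is join irreducible. The nucleus of $a\in L$ is $a_\downarrow=a\wedge\bigwedge_{b\lessdot a}b$. The core label set of $a$ is $\Psi(a)=\{\lambda(b,b')\mid a_\downarrow\leq b\lessdot b'\leq a\}$. The map $a\mapsto\Psi(a)$ is injective. The core label order $\mathrm{CLO}(L)$ is the poset $(L,\sqsubseteq)$ where $a\sqsubseteq b$ if and only if $\Psi(a)\subseteq\Psi(b)$.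 Triangles. The poset $\mathrm{CLO}(\mathrm{Hoch}(n))$ is graded with least element $(0,\ldots,0)$; let $\mathrm{rk}$ be its rank function (so $\mathrm{rk}(0,\ldots,0)=0$) and $\mu_n$ its Möbius function (with $\mu_n(u,v)=0$ if $u\not\sqsubseteq v$). Define $$M_n(x,y)=\sum_{u,v\in\mathrm{Tri}(n)}\mu_n(u,v)\,x^{\mathrm{rk}(u)}y^{\mathrm{rk}(v)},$$ $$F_n(x,y)=y^n M_n\left(\frac{y+1}{y-x},\frac{y-x}{y}\right),\qquad H_n(x,y)=\bigl(x(y-1)+1\bigr)^n M_n\left(\frac{y}{y-1},\frac{x(y-1)}{x(y-1)+1}\right).$$ -}

module Defs where

open import Level using (Level; _⊔_; 0ℓ) renaming (suc to lsuc)
open import Algebra.Apartness using (HeytingField)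
open import Algebra.Bundles using (CommutativeRing; Semiring)
import Algebra.Definitions.RawSemiring as RawSemiringDefs
import Algebra.Properties.Ring as RingProperties
import Algebra.Solver.Ring.NaturalCoefficients.Default as SemiringSolver
open import Data.Bool.Base using (if_then_else_)
open import Data.Empty using (⊥-elim)
open import Data.Fin.Base as Fin using (Fin; zero; suc; toℕ)
open import Data.Fin.Patterns using (0F; 1F; 2F)
import Data.Fin.Properties as Finₚ
open import Data.Integer.Base as ℤ using (ℤ; +_; -[1+_]; 0ℤ; 1ℤ)
open import Data.Irrelevant using (Irrelevant; [_])
open import Data.List.Base using (List; []; _∷_; map; foldr; filter; allFin; cartesianProductWith)
open import Data.List.Membership.Propositional using (_∈_; lose)
open import Data.List.Membership.Propositional.Properties using (∈-allFin; ∈-cartesianProductWith⁺)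
open import Data.List.Relation.Unary.All as All using (All)
open import Data.List.Relation.Unary.AllPairs using ([]; _∷_)
open import Data.List.Relation.Unary.Any as Any using (Any; here; there)
open import Data.List.Relation.Unary.Unique.Propositional using (Unique)
import Data.List.Relation.Unary.Unique.Propositional.Properties as Uniqueₚ
open import Data.Nat.Base as ℕ using (ℕ; zero; suc)
import Data.Nat.Properties as ℕₚ
open import Data.Product.Base using (Σ; ∃; ∃₂; _×_; _,_; proj₁; proj₂)
open import Data.Rational.Base as ℚ using (ℚ; 0ℚ; 1ℚ)
import Data.Rational.Properties as ℚₚ
open import Data.Refinement using (Refinement; _,_; value)
import Data.Refinement.Properties as Refinementₚ
open import Data.Sum.Base as Sum using (_⊎_; inj₁; inj₂; [_,_]′)
open import Data.Vec.Base as Vec using (Vec; []; _∷_; lookup; tabulate; zipWith)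
import Data.Vec.Properties as Vecₚ
open import Function.Base using (_∘_; _∋_; case_of_)
open import Relation.Binary.Core using (Rel)
open import Relation.Binary.Definitions using (Decidable; DecidableEquality; Minimum)
open import Relation.Binary.Lattice.Structures using (IsLattice)
open import Relation.Binary.PropositionalEquality.Core using (_≡_; _≢_; refl; sym; trans; cong; cong₂; subst)
import Relation.Binary.PropositionalEquality.Properties as ≡
import Relation.Binary.Reasoning.Setoid as SetoidReasoning
open import Relation.Nullary using (¬_; Dec; yes; no; contradiction)
open import Relation.Nullary.Decidable using (does; _×-dec_; _→-dec_; ¬?; map′; recompute; from-no; decidable-stable)
open import Relation.Unary using (Pred; _⊆_)
import Relation.Unary as U

record DecIntegralDomain c ℓ : Set (lsuc (c ⊔ ℓ)) where
  field
    commutativeRing : CommutativeRing c ℓ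
  open CommutativeRing commutativeRing public
  field
    1≉0             : ¬ (1# ≈ 0#)
    noZeroDivisors  : ∀ a b → a * b ≈ 0# → a ≈ 0# ⊎ b ≈ 0#
    _≟_             : Decidable _≈_

-- The polynomial a₀ + a₁X + ⋯ + aₘXᵐ is represented by its list of
-- coefficients a₀ ∷ a₁ ∷ ⋯ ∷ aₘ ∷ []; trailing zeros are permitted, and
-- equality is equality of all coefficients.

module Polynomial {c ℓ} (R : DecIntegralDomain c ℓ) where

  private
    module R = DecIntegralDomain R
  open R using (_≈_; _+_; _*_; -_; 0#; 1#)

  Poly : Set c
  Poly = List R.Carrier

  coeff : Poly → ℕ → R.Carrier
  coeff []      _       = 0#
  coeff (a ∷ p) zero    = a
  coeff (a ∷ p) (suc i) = coeff p i

  infix 4 _≋_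
  record _≋_ (p q : Poly) : Set ℓ where
    constructor mk
    field coeff-≈ : ∀ i → coeff p i ≈ coeff q i
  open _≋_ public

  infixl 6 _⊕_
  infixl 7 _⊛_ _·_

  _⊕_ : Poly → Poly → Poly
  []      ⊕ q       = q
  (a ∷ p) ⊕ []      = a ∷ p
  (a ∷ p) ⊕ (b ∷ q) = (a + b) ∷ (p ⊕ q)

  ⊖_ : Poly → Poly
  ⊖_ = map -_

  _·_ : R.Carrier → Poly → Poly
  a · p = map (a *_) p

  _⊛_ : Poly → Poly → Poly
  []      ⊛ q = []
  (a ∷ p) ⊛ q = a · q ⊕ (0# ∷ (p ⊛ q))

  const : R.Carrier → Poly
  const a = a ∷ []

  X : Poly
  X = 0# ∷ 1# ∷ []

  private
    ≋-refl : ∀ {p} → p ≋ p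
    ≋-refl = mk λ _ → R.refl

    ≋-sym : ∀ {p q} → p ≋ q → q ≋ p
    ≋-sym (mk e) = mk λ i → R.sym (e i)

    ≋-trans : ∀ {p q r} → p ≋ q → q ≋ r → p ≋ r
    ≋-trans (mk e) (mk f) = mk λ i → R.trans (e i) (f i)

    ∷-cong : ∀ {a b p q} → a ≈ b → p ≋ q → (a ∷ p) ≋ (b ∷ q)
    ∷-cong a≈b (mk e) = mk λ where
      zero    → a≈b
      (suc i) → e i

    tail-≋ : ∀ {a b p q} → (a ∷ p) ≋ (b ∷ q) → p ≋ q
    tail-≋ (mk e) = mk (e ∘ suc)

    0∷ : ∀ {a p} → a ≈ 0# → p ≋ [] → (a ∷ p) ≋ []
    0∷ a≈0 (mk e) = mk λ where
      zero    → a≈0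
      (suc i) → e i

    tail-≋[] : ∀ {a p} → (a ∷ p) ≋ [] → p ≋ []
    tail-≋[] (mk e) = mk (e ∘ suc)

    coeff-⊕ : ∀ p q i → coeff (p ⊕ q) i ≈ coeff p i + coeff q i
    coeff-⊕ []      q       i       = R.sym (R.+-identityˡ _)
    coeff-⊕ (a ∷ p) []      i       = R.sym (R.+-identityʳ _)
    coeff-⊕ (a ∷ p) (b ∷ q) zero    = R.refl
    coeff-⊕ (a ∷ p) (b ∷ q) (suc i) = coeff-⊕ p q i

    coeff-⊖ : ∀ p i → coeff (⊖ p) i ≈ - coeff p i
    coeff-⊖ []      i       = R.sym (RingProperties.-0#≈0# R.ring)
    coeff-⊖ (a ∷ p) zero    = R.refl
    coeff-⊖ (a ∷ p) (suc i) = coeff-⊖ p i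

    coeff-· : ∀ a p i → coeff (a · p) i ≈ a * coeff p i
    coeff-· a []      i       = R.sym (R.zeroʳ a)
    coeff-· a (b ∷ p) zero    = R.refl
    coeff-· a (b ∷ p) (suc i) = coeff-· a p i

    ⊕-cong : ∀ {p q r s} → p ≋ q → r ≋ s → p ⊕ r ≋ q ⊕ s
    ⊕-cong {p} {q} {r} {s} (mk e) (mk f) = mk λ i →
      R.trans (coeff-⊕ p r i) (R.trans (R.+-cong (e i) (f i)) (R.sym (coeff-⊕ q s i)))

    ⊕-assoc : ∀ p q r → (p ⊕ q) ⊕ r ≋ p ⊕ (q ⊕ r)
    ⊕-assoc []      q       r       = ≋-refl
    ⊕-assoc (a ∷ p) []      r       = ≋-refl
    ⊕-assoc (a ∷ p) (b ∷ q) []      = ≋-refl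
    ⊕-assoc (a ∷ p) (b ∷ q) (c ∷ r) = ∷-cong (R.+-assoc a b c) (⊕-assoc p q r)

    ⊕-comm : ∀ p q → p ⊕ q ≋ q ⊕ p
    ⊕-comm p q = mk λ i →
      R.trans (coeff-⊕ p q i) (R.trans (R.+-comm _ _) (R.sym (coeff-⊕ q p i)))

    ⊕-identityʳ : ∀ p → p ⊕ [] ≋ p
    ⊕-identityʳ p = ⊕-comm p []

    ⊖-cong : ∀ {p q} → p ≋ q → ⊖ p ≋ ⊖ q
    ⊖-cong {p} {q} (mk e) = mk λ i →
      R.trans (coeff-⊖ p i) (R.trans (R.-‿cong (e i)) (R.sym (coeff-⊖ q i)))

    ⊖-inverseˡ : ∀ p → (⊖ p) ⊕ p ≋ []
    ⊖-inverseˡ []      = ≋-refl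
    ⊖-inverseˡ (a ∷ p) = 0∷ (R.-‿inverseˡ a) (⊖-inverseˡ p)

    ·-cong : ∀ {a b p q} → a ≈ b → p ≋ q → a · p ≋ b · q
    ·-cong {a} {b} {p} {q} a≈b (mk e) = mk λ i →
      R.trans (coeff-· a p i) (R.trans (R.*-cong a≈b (e i)) (R.sym (coeff-· b q i)))

    ·-zeroˡ : ∀ {a} p → a ≈ 0# → a · p ≋ []
    ·-zeroˡ p a≈0 = mk λ i →
      R.trans (coeff-· _ p i) (R.trans (R.*-congʳ a≈0) (R.zeroˡ _))

    ·-identity : ∀ p → 1# · p ≋ p
    ·-identity p = mk λ i → R.trans (coeff-· 1# p i) (R.*-identityˡ _)

    ·-assoc : ∀ a b p → (a * b) · p ≋ a · (b · p)
    ·-assoc a b []      = ≋-refl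
    ·-assoc a b (c ∷ p) = ∷-cong (R.*-assoc a b c) (·-assoc a b p)

    ·-distribˡ : ∀ a p q → a · (p ⊕ q) ≋ a · p ⊕ a · q
    ·-distribˡ a []      q       = ≋-refl
    ·-distribˡ a (b ∷ p) []      = ≋-refl
    ·-distribˡ a (b ∷ p) (c ∷ q) = ∷-cong (R.distribˡ a b c) (·-distribˡ a p q)

    ·-distribʳ : ∀ a b p → (a + b) · p ≋ a · p ⊕ b · p
    ·-distribʳ a b []      = ≋-refl
    ·-distribʳ a b (c ∷ p) = ∷-cong (R.distribʳ c a b) (·-distribʳ a b p)

    ⊕-swap : ∀ p q r s → (p ⊕ q) ⊕ (r ⊕ s) ≋ (p ⊕ r) ⊕ (q ⊕ s)
    ⊕-swap p q r s =
      ≋-trans (⊕-assoc p q (r ⊕ s)) (≋-trans (⊕-cong (≋-refl {p})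
        (≋-trans (≋-sym (⊕-assoc q r s)) (≋-trans (⊕-cong (⊕-comm q r) ≋-refl) (⊕-assoc r q s))))
        (≋-sym (⊕-assoc p r (q ⊕ s))))

    ⊛-≋[] : ∀ {p} q → p ≋ [] → p ⊛ q ≋ []
    ⊛-≋[] {[]}    q e = ≋-refl
    ⊛-≋[] {a ∷ p} q e =
      ⊕-cong (·-zeroˡ q (coeff-≈ e 0)) (0∷ R.refl (⊛-≋[] {p} q (tail-≋[] e)))

    ⊛-congʳ : ∀ {p p′} q → p ≋ p′ → p ⊛ q ≋ p′ ⊛ q
    ⊛-congʳ {[]}    {p′}     q e = ≋-sym (⊛-≋[] q (≋-sym e))
    ⊛-congʳ {a ∷ p} {[]}     q e = ⊛-≋[] q e
    ⊛-congʳ {a ∷ p} {b ∷ p′} q e =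
      ⊕-cong (·-cong (coeff-≈ e 0) (≋-refl {q})) (∷-cong R.refl (⊛-congʳ q (tail-≋ e)))

    ⊛-[] : ∀ p → p ⊛ [] ≋ []
    ⊛-[] []      = ≋-refl
    ⊛-[] (a ∷ p) = 0∷ R.refl (⊛-[] p)

    ⊛-∷ : ∀ p b q → p ⊛ (b ∷ q) ≋ b · p ⊕ (0# ∷ (p ⊛ q))
    ⊛-∷ []      b q = ≋-sym (0∷ R.refl ≋-refl)
    ⊛-∷ (a ∷ p) b q = ∷-cong (R.+-congʳ (R.*-comm a b))
      (≋-trans (⊕-cong (≋-refl {a · q}) (⊛-∷ p b q))
        (≋-trans (≋-sym (⊕-assoc (a · q) (b · p) _))
          (≋-trans (⊕-cong (⊕-comm (a · q) (b · p)) ≋-refl) (⊕-assoc (b · p) (a · q) _))))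

    ⊛-comm : ∀ p q → p ⊛ q ≋ q ⊛ p
    ⊛-comm []      q = ≋-sym (⊛-[] q)
    ⊛-comm (a ∷ p) q =
      ≋-trans (⊕-cong (≋-refl {a · q}) (∷-cong R.refl (⊛-comm p q))) (≋-sym (⊛-∷ q a p))

    ⊛-cong : ∀ {p p′ q q′} → p ≋ p′ → q ≋ q′ → p ⊛ q ≋ p′ ⊛ q′
    ⊛-cong {p} {p′} {q} {q′} e f =
      ≋-trans (⊛-congʳ q e) (≋-trans (⊛-comm p′ q) (≋-trans (⊛-congʳ p′ f) (⊛-comm q′ p′)))

    ⊛-distribʳ : ∀ r p q → (p ⊕ q) ⊛ r ≋ p ⊛ r ⊕ q ⊛ r
    ⊛-distribʳ r []      q       = ≋-refl
    ⊛-distribʳ r (a ∷ p) []      = ≋-sym (⊕-identityʳ _)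
    ⊛-distribʳ r (a ∷ p) (b ∷ q) =
      ≋-trans (⊕-cong (·-distribʳ a b r)
                (∷-cong (R.sym (R.+-identityˡ 0#)) (⊛-distribʳ r p q)))
              (⊕-swap (a · r) (b · r) (0# ∷ (p ⊛ r)) (0# ∷ (q ⊛ r)))

    ·-⊛ : ∀ a q r → (a · q) ⊛ r ≋ a · (q ⊛ r)
    ·-⊛ a []      r = ≋-refl
    ·-⊛ a (b ∷ q) r =
      ≋-trans (⊕-cong (·-assoc a b r) (∷-cong (R.sym (R.zeroʳ a)) (·-⊛ a q r)))
              (≋-sym (·-distribˡ a (b · r) (0# ∷ (q ⊛ r))))

    0∷-⊛ : ∀ p q → (0# ∷ p) ⊛ q ≋ 0# ∷ (p ⊛ q)
    0∷-⊛ p q = ⊕-cong (·-zeroˡ q R.refl) ≋-refl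

    ⊛-assoc : ∀ p q r → (p ⊛ q) ⊛ r ≋ p ⊛ (q ⊛ r)
    ⊛-assoc []      q r = ≋-refl
    ⊛-assoc (a ∷ p) q r =
      ≋-trans (⊛-distribʳ r (a · q) (0# ∷ (p ⊛ q)))
              (⊕-cong (·-⊛ a q r) (≋-trans (0∷-⊛ (p ⊛ q) r) (∷-cong R.refl (⊛-assoc p q r))))

    ⊛-identityˡ : ∀ p → const 1# ⊛ p ≋ p
    ⊛-identityˡ p =
      ≋-trans (⊕-cong (·-identity p) (0∷ R.refl ≋-refl)) (⊕-identityʳ p)

    ≋-dec : Decidable _≋_
    ≋-dec []      []      = yes ≋-refl
    ≋-dec []      (b ∷ q) =
      map′ (λ (h , t) → ≋-sym (0∷ h (≋-sym t))) (λ e → R.sym (coeff-≈ e 0) , mk (coeff-≈ e ∘ suc))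
           ((b R.≟ 0#) ×-dec ≋-dec [] q)
    ≋-dec (a ∷ p) []      =
      map′ (λ (h , t) → 0∷ h t) (λ e → coeff-≈ e 0 , tail-≋[] e) ((a R.≟ 0#) ×-dec ≋-dec p [])
    ≋-dec (a ∷ p) (b ∷ q) =
      map′ (λ (h , t) → ∷-cong h t) (λ e → coeff-≈ e 0 , tail-≋ e) ((a R.≟ b) ×-dec ≋-dec p q)

    noZeroDiv-step : ∀ a p b q → (a ∷ p) ⊛ (b ∷ q) ≋ [] →
                     (p ⊛ (b ∷ q) ≋ [] → p ≋ [] ⊎ (b ∷ q) ≋ []) →
                     ((a ∷ p) ⊛ q ≋ [] → (a ∷ p) ≋ [] ⊎ q ≋ []) →
                     (a ∷ p) ≋ [] ⊎ (b ∷ q) ≋ []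
    noZeroDiv-step a p b q e ihˡ ihʳ
      with R.noZeroDivisors a b (R.trans (R.sym (R.+-identityʳ (a * b))) (coeff-≈ e 0))
    ... | inj₁ a≈0 = Sum.map₁ (0∷ a≈0) (ihˡ (tail-≋[] (≋-trans
            (≋-sym (⊕-cong (·-zeroˡ (b ∷ q) a≈0) ≋-refl)) e)))
    ... | inj₂ b≈0 = Sum.map₂ (0∷ b≈0) (ihʳ (tail-≋[] (≋-trans
            (≋-sym (≋-trans (⊛-∷ (a ∷ p) b q) (⊕-cong (·-zeroˡ (a ∷ p) b≈0) ≋-refl))) e)))

    noZeroDiv : ∀ p q → p ⊛ q ≋ [] → p ≋ [] ⊎ q ≋ []
    noZeroDiv []      q       e = inj₁ ≋-refl
    noZeroDiv (a ∷ p) []      e = inj₂ ≋-refl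
    noZeroDiv (a ∷ p) (b ∷ q) e =
      noZeroDiv-step a p b q e (noZeroDiv p (b ∷ q)) (noZeroDiv (a ∷ p) q)

  polynomialRing : CommutativeRing c ℓ
  polynomialRing = record
    { Carrier = Poly ; _≈_ = _≋_ ; _+_ = _⊕_ ; _*_ = _⊛_ ; -_ = ⊖_ ; 0# = [] ; 1# = const 1#
    ; isCommutativeRing = record
      { isRing = record
        { +-isAbelianGroup = record
          { isGroup = record
            { isMonoid = record
              { isSemigroup = record
                { isMagma = record
                  { isEquivalence = record { refl = ≋-refl ; sym = ≋-sym ; trans = ≋-trans }
                  ; ∙-cong = ⊕-cong }
                ; assoc = ⊕-assoc }
              ; identity = (λ _ → ≋-refl) , ⊕-identityʳ }
            ; inverse = ⊖-inverseˡ , λ p → ≋-trans (⊕-comm p (⊖ p)) (⊖-inverseˡ p)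
            ; ⁻¹-cong = ⊖-cong }
          ; comm = ⊕-comm }
        ; *-cong = ⊛-cong
        ; *-assoc = ⊛-assoc
        ; *-identity = ⊛-identityˡ , λ p → ≋-trans (⊛-comm p _) (⊛-identityˡ p)
        ; distrib = (λ p q r → ≋-trans (⊛-comm p (q ⊕ r)) (≋-trans (⊛-distribʳ p q r)
                                 (⊕-cong (⊛-comm q p) (⊛-comm r p))))
                  , ⊛-distribʳ }
      ; *-comm = ⊛-comm } }

  polynomialDomain : DecIntegralDomain c ℓ
  polynomialDomain = record
    { commutativeRing = polynomialRing
    ; 1≉0             = λ e → R.1≉0 (coeff-≈ e 0)
    ; noZeroDivisors  = noZeroDiv
    ; _≟_             = ≋-dec
    }

module FractionField {c ℓ} (R : DecIntegralDomain c ℓ) where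

  private
    module R = DecIntegralDomain R
  open R using (_≈_; _+_; _*_; -_; 0#; 1#)

  record Fraction : Set (c ⊔ ℓ) where
    constructor _/_∣_
    field
      num   : R.Carrier
      den   : R.Carrier
      den≉0 : ¬ (den ≈ 0#)
  open Fraction public

  embed : R.Carrier → Fraction
  embed a = a / 1# ∣ R.1≉0

  infix 4 _≃_
  record _≃_ (s t : Fraction) : Set ℓ where
    constructor mk
    field cross : num s * den t ≈ num t * den s
  open _≃_ public

  private
    *-≉0 : ∀ {a b} → ¬ (a ≈ 0#) → ¬ (b ≈ 0#) → ¬ (a * b ≈ 0#)
    *-≉0 a≉0 b≉0 ab≈0 = [ a≉0 , b≉0 ]′ (R.noZeroDivisors _ _ ab≈0)

  _⊕_ _⊛_ : Fraction → Fraction → Fraction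
  s ⊕ t = (num s * den t + num t * den s) / (den s * den t) ∣ *-≉0 (den≉0 s) (den≉0 t)
  s ⊛ t = (num s * num t) / (den s * den t) ∣ *-≉0 (den≉0 s) (den≉0 t)

  ⊖_ : Fraction → Fraction
  ⊖ s = (- num s) / den s ∣ den≉0 s

  0ᶠ 1ᶠ : Fraction
  0ᶠ = embed 0#
  1ᶠ = embed 1#

  private
    module S = SemiringSolver R.commutativeSemiring
    open S using (_:=_; _:+_; _:*_)
    open SetoidReasoning R.setoid

    *-cancelʳ : ∀ {a b} d → ¬ (d ≈ 0#) → a * d ≈ b * d → a ≈ b
    *-cancelʳ {a} {b} d d≉0 e = [ x-y≈0⇒x≈y , (λ d≈0 → ⊥-elim (d≉0 d≈0)) ]′ (R.noZeroDivisors _ d (begin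
      (a + - b) * d       ≈⟨ R.distribʳ d a (- b) ⟩
      a * d + - b * d     ≈⟨ R.+-cong e (R.sym (RingProperties.-‿distribˡ-* R.ring b d)) ⟩
      b * d + - (b * d)   ≈⟨ R.-‿inverseʳ _ ⟩
      0#                  ∎))
      where
      x-y≈0⇒x≈y : a + - b ≈ 0# → a ≈ b
      x-y≈0⇒x≈y = RingProperties.x∙y⁻¹≈ε⇒x≈y R.ring a b

    ≃-refl : ∀ {s} → s ≃ s
    ≃-refl = mk R.refl

    ≃-sym : ∀ {s t} → s ≃ t → t ≃ s
    ≃-sym (mk e) = mk (R.sym e)

    ≃-trans : ∀ {s t u} → s ≃ t → t ≃ u → s ≃ u
    ≃-trans {a / b ∣ _} {c / d ∣ d≉0} {e / f ∣ _} (mk p) (mk q) = mk (*-cancelʳ d d≉0 (begin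
      (a * f) * d ≈⟨ S.solve 3 (λ a f d → ((a :* f) :* d) := ((a :* d) :* f)) R.refl a f d ⟩
      (a * d) * f ≈⟨ R.*-congʳ p ⟩
      (c * b) * f ≈⟨ S.solve 3 (λ c b f → ((c :* b) :* f) := ((c :* f) :* b)) R.refl c b f ⟩
      (c * f) * b ≈⟨ R.*-congʳ q ⟩
      (e * d) * b ≈⟨ S.solve 3 (λ e d b → ((e :* d) :* b) := ((e :* b) :* d)) R.refl e d b ⟩
      (e * b) * d ∎))

    ⊕-cong : ∀ {s s′ t t′} → s ≃ s′ → t ≃ t′ → s ⊕ t ≃ s′ ⊕ t′
    ⊕-cong {a / b ∣ _} {a′ / b′ ∣ _} {c / d ∣ _} {c′ / d′ ∣ _} (mk p) (mk q) = mk (begin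
      (a * d + c * b) * (b′ * d′)
        ≈⟨ S.solve 6 (λ a b c d b′ d′ → ((a :* d :+ c :* b) :* (b′ :* d′)) := ((a :* b′) :* (d :* d′) :+ (c :* d′) :* (b :* b′))) R.refl a b c d b′ d′ ⟩
      (a * b′) * (d * d′) + (c * d′) * (b * b′)
        ≈⟨ R.+-cong (R.*-congʳ p) (R.*-congʳ q) ⟩
      (a′ * b) * (d * d′) + (c′ * d) * (b * b′)
        ≈⟨ S.solve 6 (λ a′ b c′ d b′ d′ → ((a′ :* b) :* (d :* d′) :+ (c′ :* d) :* (b :* b′)) := ((a′ :* d′ :+ c′ :* b′) :* (b :* d))) R.refl a′ b c′ d b′ d′ ⟩
      (a′ * d′ + c′ * b′) * (b * d) ∎)

    ⊛-cong : ∀ {s s′ t t′} → s ≃ s′ → t ≃ t′ → s ⊛ t ≃ s′ ⊛ t′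
    ⊛-cong {a / b ∣ _} {a′ / b′ ∣ _} {c / d ∣ _} {c′ / d′ ∣ _} (mk p) (mk q) = mk (begin
      (a * c) * (b′ * d′) ≈⟨ S.solve 4 (λ a c b′ d′ → ((a :* c) :* (b′ :* d′)) := ((a :* b′) :* (c :* d′))) R.refl a c b′ d′ ⟩
      (a * b′) * (c * d′) ≈⟨ R.*-cong p q ⟩
      (a′ * b) * (c′ * d) ≈⟨ S.solve 4 (λ a′ b c′ d → ((a′ :* b) :* (c′ :* d)) := ((a′ :* c′) :* (b :* d))) R.refl a′ b c′ d ⟩
      (a′ * c′) * (b * d) ∎)

    ⊖-cong : ∀ {s t} → s ≃ t → ⊖ s ≃ ⊖ t
    ⊖-cong {a / b ∣ _} {c / d ∣ _} (mk p) = mk (begin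
      - a * d   ≈⟨ RingProperties.-‿distribˡ-* R.ring a d ⟨
      - (a * d) ≈⟨ R.-‿cong p ⟩
      - (c * b) ≈⟨ RingProperties.-‿distribˡ-* R.ring c b ⟩
      - c * b   ∎)

    ⊕-assoc : ∀ s t u → (s ⊕ t) ⊕ u ≃ s ⊕ (t ⊕ u)
    ⊕-assoc (a / b ∣ _) (c / d ∣ _) (e / f ∣ _) = mk (S.solve 6 (λ a b c d e f →
      (((a :* d :+ c :* b) :* f :+ e :* (b :* d)) :* (b :* (d :* f))) :=
      ((a :* (d :* f) :+ (c :* f :+ e :* d) :* b) :* ((b :* d) :* f))) R.refl a b c d e f)

    ⊕-comm : ∀ s t → s ⊕ t ≃ t ⊕ s
    ⊕-comm (a / b ∣ _) (c / d ∣ _) = mk (S.solve 4 (λ a b c d →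
      ((a :* d :+ c :* b) :* (d :* b)) := ((c :* b :+ a :* d) :* (b :* d))) R.refl a b c d)

    ⊕-identityˡ : ∀ s → 0ᶠ ⊕ s ≃ s
    ⊕-identityˡ (a / b ∣ _) = mk (begin
      (0# * b + a * 1#) * b ≈⟨ R.*-congʳ (R.trans (R.+-cong (R.zeroˡ b) (R.*-identityʳ a)) (R.+-identityˡ a)) ⟩
      a * b                 ≈⟨ R.*-congˡ (R.*-identityˡ b) ⟨
      a * (1# * b)          ∎)

    ≃0 : ∀ {s} → num s ≈ 0# → s ≃ 0ᶠ
    ≃0 e = mk (R.trans (R.*-congʳ e) (R.trans (R.zeroˡ 1#) (R.sym (R.zeroˡ _))))

    ≃0⇒ : ∀ {s} → s ≃ 0ᶠ → num s ≈ 0#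
    ≃0⇒ {a / b ∣ _} (mk e) = R.trans (R.sym (R.*-identityʳ a)) (R.trans e (R.zeroˡ b))

    ⊖-inverseˡ : ∀ s → (⊖ s) ⊕ s ≃ 0ᶠ
    ⊖-inverseˡ (a / b ∣ _) = ≃0 (begin
      - a * b + a * b ≈⟨ R.distribʳ b (- a) a ⟨
      (- a + a) * b   ≈⟨ R.*-congʳ (R.-‿inverseˡ a) ⟩
      0# * b          ≈⟨ R.zeroˡ b ⟩
      0#              ∎)

    ⊛-assoc : ∀ s t u → (s ⊛ t) ⊛ u ≃ s ⊛ (t ⊛ u)
    ⊛-assoc (a / b ∣ _) (c / d ∣ _) (e / f ∣ _) = mk (R.*-cong (R.*-assoc a c e) (R.sym (R.*-assoc b d f)))

    ⊛-comm : ∀ s t → s ⊛ t ≃ t ⊛ s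
    ⊛-comm (a / b ∣ _) (c / d ∣ _) = mk (R.*-cong (R.*-comm a c) (R.*-comm d b))

    ⊛-identityˡ : ∀ s → 1ᶠ ⊛ s ≃ s
    ⊛-identityˡ (a / b ∣ _) = mk (R.*-cong (R.*-identityˡ a) (R.sym (R.*-identityˡ b)))

    ⊛-distribʳ : ∀ u s t → (s ⊕ t) ⊛ u ≃ (s ⊛ u) ⊕ (t ⊛ u)
    ⊛-distribʳ (e / f ∣ _) (a / b ∣ _) (c / d ∣ _) = mk (S.solve 6 (λ a b c d e f →
      (((a :* d :+ c :* b) :* e) :* ((b :* f) :* (d :* f))) :=
      (((a :* e) :* (d :* f) :+ (c :* e) :* (b :* f)) :* ((b :* d) :* f))) R.refl a b c d e f)

  ≃-dec : Decidable _≃_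
  ≃-dec s t = map′ mk cross ((num s * den t) R.≟ (num t * den s))

  fractionRing : CommutativeRing (c ⊔ ℓ) ℓ
  fractionRing = record
    { Carrier = Fraction ; _≈_ = _≃_ ; _+_ = _⊕_ ; _*_ = _⊛_ ; -_ = ⊖_ ; 0# = 0ᶠ ; 1# = 1ᶠ
    ; isCommutativeRing = record
      { isRing = record
        { +-isAbelianGroup = record
          { isGroup = record
            { isMonoid = record
              { isSemigroup = record
                { isMagma = record
                  { isEquivalence = record { refl = ≃-refl ; sym = ≃-sym ; trans = ≃-trans }
                  ; ∙-cong = ⊕-cong }
                ; assoc = ⊕-assoc }
              ; identity = ⊕-identityˡ , λ s → ≃-trans (⊕-comm s 0ᶠ) (⊕-identityˡ s) }
            ; inverse = ⊖-inverseˡ , λ s → ≃-trans (⊕-comm s (⊖ s)) (⊖-inverseˡ s)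
            ; ⁻¹-cong = ⊖-cong }
          ; comm = ⊕-comm }
        ; *-cong = ⊛-cong
        ; *-assoc = ⊛-assoc
        ; *-identity = ⊛-identityˡ , λ s → ≃-trans (⊛-comm s 1ᶠ) (⊛-identityˡ s)
        ; distrib = (λ s t u → ≃-trans (⊛-comm s (t ⊕ u)) (≃-trans (⊛-distribʳ s t u)
                                 (⊕-cong (⊛-comm t s) (⊛-comm u s))))
                  , ⊛-distribʳ }
      ; *-comm = ⊛-comm } }

  -- Equality of fractions is decidable, so "not equal" is an apartness.

  fractionField : HeytingField (c ⊔ ℓ) ℓ ℓ
  fractionField = record
    { _#_ = λ s t → ¬ (s ≃ t)
    ; isHeytingField = record
      { isHeytingCommutativeRing = record
        { isCommutativeRing = CommutativeRing.isCommutativeRing fractionRing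
        ; isApartnessRelation = record
          { irrefl  = λ e ¬e → ¬e e
          ; sym     = λ ¬e e → ¬e (≃-sym e)
          ; cotrans = λ {s} {t} s#t u → case ≃-dec s u of λ where
              (no s#u)  → inj₁ s#u
              (yes s≃u) → inj₂ λ u≃t → s#t (≃-trans s≃u u≃t) }
        ; #⇒invertible = λ {s} {t} → invert s t
        ; invertible⇒# = λ {s} {t} (i , _ , e) s≃t → R.1≉0 (≃0⇒
            (≃-trans (≃-sym e) (≃-trans (⊛-cong {t = i} (diff s t s≃t) ≃-refl) (≃0 (R.zeroˡ _))))) }
      ; tight = λ s t → (λ ¬¬e → decidable-stable (≃-dec s t) ¬¬e) , λ e ¬e → ¬e e } }
    where
    module Q = CommutativeRing fractionRing

    diff : ∀ s t → s ≃ t → s ⊕ (⊖ t) ≃ 0ᶠ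
    diff s t e = ≃-trans (⊕-cong {t = ⊖ t} e ≃-refl) (Q.-‿inverseʳ t)

    invert : ∀ s t → ¬ (s ≃ t) →
             Σ Fraction λ i → (i ⊛ (s ⊕ (⊖ t)) ≃ 1ᶠ) × ((s ⊕ (⊖ t)) ⊛ i ≃ 1ᶠ)
    invert s t s#t = i , ≃-trans (⊛-comm i d) right , right
      where
      d : Fraction
      d = s ⊕ (⊖ t)

      num-d≉0 : ¬ (num d ≈ 0#)
      num-d≉0 e = s#t (RingProperties.x∙y⁻¹≈ε⇒x≈y Q.ring s t (≃0 {d} e))

      i : Fraction
      i = den d / num d ∣ num-d≉0

      right : d ⊛ i ≃ 1ᶠ
      right = mk (R.trans (R.*-identityʳ _) (R.trans (R.*-comm (num d) (den d)) (R.sym (R.*-identityˡ _))))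

ℚ-domain : DecIntegralDomain 0ℓ 0ℓ
ℚ-domain = record
  { commutativeRing = ℚₚ.+-*-commutativeRing
  ; 1≉0             = λ ()
  ; noZeroDivisors  = noZeroDiv
  ; _≟_             = ℚₚ._≟_
  }
  where
  noZeroDiv : ∀ p q → p ℚ.* q ≡ 0ℚ → p ≡ 0ℚ ⊎ q ≡ 0ℚ
  noZeroDiv p q pq≡0 with p ℚₚ.≟ 0ℚ
  ... | yes p≡0 = inj₁ p≡0
  ... | no  p≢0 = inj₂ (trans (sym (ℚₚ.*-identityˡ q))
                  (trans (cong (ℚ._* q) (sym (ℚₚ.*-inverseˡ p)))
                  (trans (ℚₚ.*-assoc (ℚ.1/ p) p q)
                  (trans (cong ((ℚ.1/ p) ℚ.*_) pq≡0) (ℚₚ.*-zeroʳ (ℚ.1/ p))))))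
    where instance _ = ℚ.≢-nonZero p≢0

-- ℚ(x,y) is the field of fractions of ℚ[x][y].

module ℚ[x]    = Polynomial ℚ-domain
module ℚ[x][y] = Polynomial ℚ[x].polynomialDomain
module ℚ⟮x,y⟯  = FractionField ℚ[x][y].polynomialDomain

ℚ⟮x,y⟯-field : HeytingField 0ℓ 0ℓ 0ℓ
ℚ⟮x,y⟯-field = ℚ⟮x,y⟯.fractionField

module FieldArithmetic {c ℓ₁ ℓ₂} (K : HeytingField c ℓ₁ ℓ₂) where

  open HeytingField K
  private
    ring : CommutativeRing c ℓ₁
    ring = record { isCommutativeRing = isCommutativeRing }

  open RawSemiringDefs (Semiring.rawSemiring (CommutativeRing.semiring ring)) public using (_^_)
  open RawSemiringDefs (Semiring.rawSemiring (CommutativeRing.semiring ring)) using () renaming (_×_ to _×ℕ_)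

  infixr 8 _·_
  _·_ : ℤ → Carrier → Carrier
  (+ m)    · a = m ×ℕ a
  -[1+ m ] · a = - (suc m ×ℕ a)

  -- The library supplies an inverse of a - 0#, which is an inverse of a.

  _⁻¹⟨_⟩ : ∀ a → a # 0# → Carrier
  a ⁻¹⟨ a#0 ⟩ = proj₁ (#⇒invertible a#0)

  infixl 7 _/_⟨_⟩
  _/_⟨_⟩ : ∀ (a b : Carrier) → b # 0# → Carrier
  a / b ⟨ b#0 ⟩ = a * b ⁻¹⟨ b#0 ⟩

  infixr 8 _⟨_⟩^_
  _⟨_⟩^_ : ∀ a → a # 0# → ℤ → Carrier
  a ⟨ a#0 ⟩^ (+ m)    = a ^ m
  a ⟨ a#0 ⟩^ -[1+ m ] = (a ⁻¹⟨ a#0 ⟩) ^ suc m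

  ∑ : ∀ {A : Set} → List A → (A → Carrier) → Carrier
  ∑ as f = foldr (λ a s → f a + s) 0# as

module _ {A : Set} (_⊑_ : Rel A 0ℓ) where

  Strict : Rel A 0ℓ
  Strict a b = a ⊑ b × a ≢ b

  Covers : Rel A 0ℓ
  Covers a b = Strict a b × ¬ ∃ λ c → Strict a c × Strict c b

  record IsRankFunction (rk : A → ℕ) : Set where
    field
      rank-least  : ∀ u → Minimum _⊑_ u → rk u ≡ 0
      rank-covers : ∀ u v → Covers u v → rk v ≡ suc (rk u)

-- The list `elements` must enumerate A without repetition.

module _ {A : Set} (elements : List A) {_⊑_ : Rel A 0ℓ} (_⊑?_ : Decidable _⊑_) where

  interval : A → A → List A
  interval u v = filter (λ w → (u ⊑? w) ×-dec (w ⊑? v)) elements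

  record IsMöbiusFunction (μ : A → A → ℤ) : Set where
    field
      μ-diagonal : ∀ u → μ u u ≡ 1ℤ
      μ-interval : ∀ u v → u ⊑ v → u ≢ v → foldr (λ w s → μ u w ℤ.+ s) 0ℤ (interval u v) ≡ 0ℤ
      μ-outside  : ∀ u v → ¬ (u ⊑ v) → μ u v ≡ 0ℤ

record FiniteLattice : Set₁ where
  infix  4 _≤_
  infixr 6 _∨_
  infixr 7 _∧_
  field
    Carrier   : Set
    _≤_       : Rel Carrier 0ℓ
    _∨_       : Carrier → Carrier → Carrier
    _∧_       : Carrier → Carrier → Carrier
    isLattice : IsLattice _≡_ _≤_ _∨_ _∧_
    _≟_       : DecidableEquality Carrier
    _≤?_      : Decidable _≤_
    elements  : List Carrier
    complete  : ∀ a → a ∈ elements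
    unique    : Unique elements

module CoreLabelOrder (L : FiniteLattice) where

  open FiniteLattice L

  private
    all? : ∀ {P : Pred Carrier 0ℓ} → U.Decidable P → Dec (∀ a → P a)
    all? P? = map′ (λ ps a → All.lookup ps (complete a)) (λ f → All.universal f elements)
                   (All.all? P? elements)

    any? : ∀ {P : Pred Carrier 0ℓ} → U.Decidable P → Dec (∃ P)
    any? P? = map′ Any.satisfied (λ (a , p) → lose (complete a) p) (Any.any? P? elements)

  infix 4 _⋖_ _⋖?_ _⊑_ _⊑?_

  _⋖_ : Rel Carrier 0ℓ
  _⋖_ = Covers _≤_

  private
    _<?_ : Decidable (Strict _≤_)
    a <? b = (a ≤? b) ×-dec ¬? (a ≟ b)

  _⋖?_ : Decidable _⋖_
  a ⋖? b = (a <? b) ×-dec ¬? (any? λ c → (a <? c) ×-dec (c <? b))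

  nucleus : Carrier → Carrier
  nucleus a = foldr _∧_ a (filter (_⋖? a) elements)

  -- IsLabel a b j says j = λ(a,b) := min { c | a ∨ c = b }.  This minimum
  -- exists for every cover a ⋖ b when L is semidistributive.

  IsLabel : Carrier → Carrier → Pred Carrier 0ℓ
  IsLabel a b j = a ∨ j ≡ b × (∀ c → a ∨ c ≡ b → j ≤ c)

  Ψ : Carrier → Pred Carrier 0ℓ
  Ψ a j = ∃₂ λ b b′ → nucleus a ≤ b × b ⋖ b′ × b′ ≤ a × IsLabel b b′ j

  _⊑_ : Rel Carrier 0ℓ
  a ⊑ b = Ψ a ⊆ Ψ b

  private
    isLabel? : ∀ a b → U.Decidable (IsLabel a b)
    isLabel? a b j = ((a ∨ j) ≟ b) ×-dec all? λ c → ((a ∨ c) ≟ b) →-dec (j ≤? c)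

    Ψ? : ∀ a → U.Decidable (Ψ a)
    Ψ? a j = any? λ b → any? λ b′ →
      (nucleus a ≤? b) ×-dec (b ⋖? b′) ×-dec (b′ ≤? a) ×-dec isLabel? b b′ j

  _⊑?_ : Decidable _⊑_
  a ⊑? b = map′ (λ f {j} → f j) (λ f j → f {j}) (all? λ j → Ψ? a j →-dec Ψ? b j)

  IsRank : (Carrier → ℕ) → Set
  IsRank = IsRankFunction _⊑_

  IsMöbius : (Carrier → Carrier → ℤ) → Set
  IsMöbius = IsMöbiusFunction elements _⊑?_

Word : ℕ → Set
Word n = Vec (Fin 3) n

-- Positions start at 0, so first≢2 is the condition u₁ ≠ 2.

record IsTriword {n} (u : Word n) : Set where
  constructor mk
  field
    first≢2 : ∀ i → toℕ i ≡ 0 → lookup u i ≢ 2F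
    no-0-1  : ∀ i j → i Fin.< j → lookup u i ≡ 0F → lookup u j ≢ 1F
open IsTriword

isTriword? : ∀ {n} → U.Decidable (IsTriword {n})
isTriword? u = map′ (λ (p , q) → mk p q) (λ t → first≢2 t , no-0-1 t)
  ((Finₚ.all? λ i → (toℕ i ℕₚ.≟ 0) →-dec ¬? (lookup u i Finₚ.≟ 2F))
   ×-dec
   (Finₚ.all? λ i → Finₚ.all? λ j →
     (i Finₚ.<? j) →-dec ((lookup u i Finₚ.≟ 0F) →-dec ¬? (lookup u j Finₚ.≟ 1F))))

-- The proof component is irrelevant, so triwords with the same entries
-- are propositionally equal.

Tri : ℕ → Set
Tri n = Refinement (Word n) IsTriword

entry : ∀ {n} → Tri n → Fin n → Fin 3
entry u = lookup (value u)

infix 4 _≤ᵀ_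
_≤ᵀ_ : ∀ {n} → Rel (Tri n) 0ℓ
u ≤ᵀ v = ∀ i → entry u i Fin.≤ entry v i

isTriword : ∀ {n} (u : Tri n) → IsTriword (value u)
isTriword (u , [ t ]) = recompute (isTriword? u) t

_⊔ᶠ_ _⊓ᶠ_ : ∀ {k} → Fin k → Fin k → Fin k
i ⊔ᶠ j = [ (λ _ → j) , (λ _ → i) ]′ (Finₚ.≤-total i j)
i ⊓ᶠ j = [ (λ _ → i) , (λ _ → j) ]′ (Finₚ.≤-total i j)

≤-⊔ˡ : ∀ {k} (i j : Fin k) → i Fin.≤ i ⊔ᶠ j
≤-⊔ˡ i j with Finₚ.≤-total i j
... | inj₁ i≤j = i≤j
... | inj₂ _   = ℕₚ.≤-refl

≤-⊔ʳ : ∀ {k} (i j : Fin k) → j Fin.≤ i ⊔ᶠ j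
≤-⊔ʳ i j with Finₚ.≤-total i j
... | inj₁ _   = ℕₚ.≤-refl
... | inj₂ j≤i = j≤i

⊔-sel : ∀ {k} (i j : Fin k) → i ⊔ᶠ j ≡ i ⊎ i ⊔ᶠ j ≡ j
⊔-sel i j with Finₚ.≤-total i j
... | inj₁ _ = inj₂ refl
... | inj₂ _ = inj₁ refl

⊓-≤ˡ : ∀ {k} (i j : Fin k) → i ⊓ᶠ j Fin.≤ i
⊓-≤ˡ i j with Finₚ.≤-total i j
... | inj₁ _   = ℕₚ.≤-refl
... | inj₂ j≤i = j≤i

⊓-≤ʳ : ∀ {k} (i j : Fin k) → i ⊓ᶠ j Fin.≤ j
⊓-≤ʳ i j with Finₚ.≤-total i j
... | inj₁ i≤j = i≤j
... | inj₂ _   = ℕₚ.≤-refl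

⊓-sel : ∀ {k} (i j : Fin k) → i ⊓ᶠ j ≡ i ⊎ i ⊓ᶠ j ≡ j
⊓-sel i j with Finₚ.≤-total i j
... | inj₁ _ = inj₁ refl
... | inj₂ _ = inj₂ refl

≤0 : ∀ {i : Fin 3} → i Fin.≤ (Fin 3 ∋ 0F) → i ≡ 0F
≤0 {0F} _ = refl

2≤ : ∀ {i : Fin 3} → (Fin 3 ∋ 2F) Fin.≤ i → i ≡ 2F
2≤ {1F} (ℕ.s≤s ())
2≤ {2F} _ = refl

-- Entries of the meet: 1 becomes 0 when the componentwise minimum m has
-- a 0 further left.

Blocked : ∀ {n} → Word n → Fin n → Set
Blocked m i = lookup m i ≡ 1F × ∃ λ j → j Fin.< i × lookup m j ≡ 0F

blocked? : ∀ {n} (m : Word n) → U.Decidable (Blocked m)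
blocked? m i = (lookup m i Finₚ.≟ 1F) ×-dec
  Finₚ.any? λ j → (j Finₚ.<? i) ×-dec (lookup m j Finₚ.≟ 0F)

repair : ∀ {n} → Word n → Word n
repair m = tabulate λ i → if does (blocked? m i) then 0F else lookup m i

data RepairView {n} (m : Word n) (i : Fin n) : Fin 3 → Set where
  zeroed : Blocked m i → RepairView m i 0F
  kept   : ¬ Blocked m i → RepairView m i (lookup m i)

repairView : ∀ {n} (m : Word n) i → RepairView m i (lookup (repair m) i)
repairView m i = subst (RepairView m i) (sym (Vecₚ.lookup∘tabulate _ i)) (view (blocked? m i))
  where
  view : (d : Dec (Blocked m i)) → RepairView m i (if does d then 0F else lookup m i)
  view (yes b) = zeroed b
  view (no ¬b) = kept ¬b

joinWord : ∀ {n} → Word n → Word n → Word n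
joinWord = zipWith _⊔ᶠ_

minWord : ∀ {n} → Word n → Word n → Word n
minWord = zipWith _⊓ᶠ_

joinWord-triword : ∀ {n} {u v : Word n} → IsTriword u → IsTriword v → IsTriword (joinWord u v)
joinWord-triword {u = u} {v} s t = mk
  (λ i i≡0 e → [ (λ e′ → first≢2 s i i≡0 (trans (sym e′) (trans (sym (look i)) e)))
               , (λ e′ → first≢2 t i i≡0 (trans (sym e′) (trans (sym (look i)) e))) ]′
               (⊔-sel (lookup u i) (lookup v i)))
  (λ i j i<j e e₁ →
    let e₀ = trans (sym (look i)) e
        u0 = ≤0 (subst (lookup u i Fin.≤_) e₀ (≤-⊔ˡ (lookup u i) (lookup v i)))
        v0 = ≤0 (subst (lookup v i Fin.≤_) e₀ (≤-⊔ʳ (lookup u i) (lookup v i)))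
    in [ (λ e′ → no-0-1 s i j i<j u0 (trans (sym e′) (trans (sym (look j)) e₁)))
       , (λ e′ → no-0-1 t i j i<j v0 (trans (sym e′) (trans (sym (look j)) e₁))) ]′
       (⊔-sel (lookup u j) (lookup v j)))
  where
  look : ∀ i → lookup (joinWord u v) i ≡ lookup u i ⊔ᶠ lookup v i
  look i = Vecₚ.lookup-zipWith _⊔ᶠ_ i u v

look-min : ∀ {n} (u v : Word n) i → lookup (minWord u v) i ≡ lookup u i ⊓ᶠ lookup v i
look-min u v i = Vecₚ.lookup-zipWith _⊓ᶠ_ i u v

repair-triword : ∀ {n} (m : Word n) → (∀ i → toℕ i ≡ 0 → lookup m i ≢ 2F) → IsTriword (repair m)
repair-triword m m-first = mk first no01
  where
  first : ∀ i → toℕ i ≡ 0 → lookup (repair m) i ≢ 2F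
  first i i≡0 with lookup (repair m) i | repairView m i
  ... | _ | zeroed _ = λ ()
  ... | _ | kept _   = m-first i i≡0

  no01 : ∀ i j → i Fin.< j → lookup (repair m) i ≡ 0F → lookup (repair m) j ≢ 1F
  no01 i j i<j with lookup (repair m) i | repairView m i | lookup (repair m) j | repairView m j
  ... | _ | _                      | _ | zeroed _ = λ _ ()
  ... | _ | zeroed (_ , k , k<i , e) | _ | kept ¬b  = λ _ e₁ → ¬b (e₁ , k , ℕₚ.<-trans k<i i<j , e)
  ... | _ | kept _                 | _ | kept ¬b  = λ e₀ e₁ → ¬b (e₁ , i , i<j , e₀)

meetWord-triword : ∀ {n} {u v : Word n} → IsTriword u → IsTriword v → IsTriword (repair (minWord u v))
meetWord-triword {u = u} {v} s t = repair-triword (minWord u v) λ i i≡0 e →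
  first≢2 s i i≡0 (2≤ (subst (Fin._≤ lookup u i) (trans (sym (look-min u v i)) e) (⊓-≤ˡ (lookup u i) (lookup v i))))

infixr 6 _∨ᵀ_
infixr 7 _∧ᵀ_

_∨ᵀ_ _∧ᵀ_ : ∀ {n} → Tri n → Tri n → Tri n
(u , [ s ]) ∨ᵀ (v , [ t ]) = joinWord u v , [ joinWord-triword s t ]
(u , [ s ]) ∧ᵀ (v , [ t ]) = repair (minWord u v) , [ meetWord-triword s t ]

private
  repair-≤ : ∀ {n} (m : Word n) i → lookup (repair m) i Fin.≤ lookup m i
  repair-≤ m i with lookup (repair m) i | repairView m i
  ... | _ | zeroed _ = ℕ.z≤n
  ... | _ | kept _   = ℕₚ.≤-refl

  ≤-repair : ∀ {n} {w m : Word n} → IsTriword w → (∀ i → lookup w i Fin.≤ lookup m i) →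
             ∀ i → lookup w i Fin.≤ lookup (repair m) i
  ≤-repair {w = w} {m} t w≤m i with lookup (repair m) i | repairView m i
  ... | _ | kept _ = w≤m i
  ... | _ | zeroed (mi≡1 , j , j<i , mj≡0) =
    ≤1∧≢1 (subst (lookup w i Fin.≤_) mi≡1 (w≤m i))
          (no-0-1 t j i j<i (≤0 (subst (lookup w j Fin.≤_) mj≡0 (w≤m j))))
    where
    ≤1∧≢1 : ∀ {a : Fin 3} → a Fin.≤ (Fin 3 ∋ 1F) → a ≢ 1F → a Fin.≤ (Fin 3 ∋ 0F)
    ≤1∧≢1 {0F} _ _ = ℕ.z≤n
    ≤1∧≢1 {1F} _ ≢1 = contradiction refl ≢1
    ≤1∧≢1 {2F} (ℕ.s≤s ()) _

  isLatticeᵀ : ∀ {n} → IsLattice (_≡_ {A = Tri n}) _≤ᵀ_ _∨ᵀ_ _∧ᵀ_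
  isLatticeᵀ = record
    { isPartialOrder = record
      { isPreorder = record
        { isEquivalence = ≡.isEquivalence
        ; reflexive     = λ { refl i → ℕₚ.≤-refl }
        ; trans         = λ p q i → ℕₚ.≤-trans (p i) (q i) }
      ; antisym = λ {u} {v} p q → Refinementₚ.value-injective (word-ext (λ i → Finₚ.≤-antisym (p i) (q i))) }
    ; supremum = λ u v →
        (λ i → subst (entry u i Fin.≤_) (sym (look u v i)) (≤-⊔ˡ (entry u i) (entry v i)))
      , (λ i → subst (entry v i Fin.≤_) (sym (look u v i)) (≤-⊔ʳ (entry u i) (entry v i)))
      , λ w p q i → subst (Fin._≤ entry w i) (sym (look u v i)) (least (p i) (q i))
    ; infimum = λ u v →
        (λ i → ℕₚ.≤-trans (repair-≤ (min u v) i) (subst (Fin._≤ entry u i) (sym (look-min (value u) (value v) i)) (⊓-≤ˡ (entry u i) (entry v i))))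
      , (λ i → ℕₚ.≤-trans (repair-≤ (min u v) i) (subst (Fin._≤ entry v i) (sym (look-min (value u) (value v) i)) (⊓-≤ʳ (entry u i) (entry v i))))
      , λ w p q → ≤-repair {m = min u v} (isTriword w)
          (λ i → subst (entry w i Fin.≤_) (sym (look-min (value u) (value v) i)) (greatest (p i) (q i)))
    }
    where
    min : ∀ {n} → Tri n → Tri n → Word n
    min u v = minWord (value u) (value v)

    look : ∀ {n} (u v : Tri n) i → entry (u ∨ᵀ v) i ≡ entry u i ⊔ᶠ entry v i
    look u v i = Vecₚ.lookup-zipWith _⊔ᶠ_ i (value u) (value v)

    word-ext : ∀ {n} {u v : Word n} → (∀ i → lookup u i ≡ lookup v i) → u ≡ v
    word-ext {u = []}    {[]}    e = refl
    word-ext {u = a ∷ u} {b ∷ v} e = cong₂ _∷_ (e zero) (word-ext (e ∘ suc))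

    least : ∀ {k} {i j l : Fin k} → i Fin.≤ l → j Fin.≤ l → i ⊔ᶠ j Fin.≤ l
    least {i = i} {j} {l} p q = [ (λ e → subst (Fin._≤ l) (sym e) p) , (λ e → subst (Fin._≤ l) (sym e) q) ]′ (⊔-sel i j)

    greatest : ∀ {k} {i j l : Fin k} → l Fin.≤ i → l Fin.≤ j → l Fin.≤ i ⊓ᶠ j
    greatest {i = i} {j} {l} p q = [ (λ e → subst (l Fin.≤_) (sym e) p) , (λ e → subst (l Fin.≤_) (sym e) q) ]′ (⊓-sel i j)

words : ∀ n → List (Word n)
words zero    = [] ∷ []
words (suc n) = cartesianProductWith _∷_ (allFin 3) (words n)

select : ∀ {n} → List (Word n) → List (Tri n)
select []       = []
select (u ∷ us) with isTriword? u
... | yes t = (u , [ t ]) ∷ select us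
... | no  _ = select us

private
  ∈-words : ∀ {n} (u : Word n) → u ∈ words n
  ∈-words []      = here refl
  ∈-words (a ∷ u) = ∈-cartesianProductWith⁺ _∷_ (∈-allFin a) (∈-words u)

  words-unique : ∀ n → Unique (words n)
  words-unique zero    = All.[] ∷ []
  words-unique (suc n) =
    Uniqueₚ.cartesianProductWith⁺ _∷_ Vecₚ.∷-injective (Uniqueₚ.allFin⁺ 3) (words-unique n)

  ∈-select : ∀ {n} {us} (u : Tri n) → value u ∈ us → u ∈ select us
  ∈-select {us = w ∷ us} u v∈ with isTriword? w | v∈
  ... | yes t | here refl = here refl
  ... | yes t | there v∈′ = there (∈-select u v∈′)
  ... | no ¬t | here refl = contradiction (isTriword u) ¬t
  ... | no ¬t | there v∈′ = ∈-select u v∈′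

  select-All : ∀ {n} {us} {w : Word n} → All (w ≢_) us → All (λ u → w ≢ value u) (select us)
  select-All {us = []}     All.[]         = All.[]
  select-All {us = u ∷ us} (p All.∷ ps) with isTriword? u
  ... | yes t = p All.∷ select-All ps
  ... | no  _ = select-All ps

  select-unique : ∀ {n} {us : List (Word n)} → Unique us → Unique (select us)
  select-unique {us = []}     []       = []
  select-unique {us = u ∷ us} (p ∷ ps) with isTriword? u
  ... | yes t = All.map (λ ≢ e → ≢ (cong value e)) (select-All p) ∷ select-unique ps
  ... | no  _ = select-unique ps

Hoch : ℕ → FiniteLattice
Hoch n = record
  { Carrier   = Tri n
  ; _≤_       = _≤ᵀ_
  ; _∨_       = _∨ᵀ_
  ; _∧_       = _∧ᵀ_
  ; isLattice = isLatticeᵀ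
  ; _≟_       = Refinementₚ._≟_ (Vecₚ.≡-dec Finₚ._≟_)
  ; _≤?_      = λ u v → Finₚ.all? λ i → entry u i Finₚ.≤? entry v i
  ; elements  = select (words n)
  ; complete  = λ u → ∈-select u (∈-words (value u))
  ; unique    = select-unique (words-unique n)
  }

open HeytingField ℚ⟮x,y⟯-field
  using (_≈_; _#_; _+_; _*_; _-_; 0#; 1#) renaming (Carrier to RationalFunction) public
open FieldArithmetic ℚ⟮x,y⟯-field public

x y : RationalFunction
x = ℚ⟮x,y⟯.embed (ℚ[x][y].const ℚ[x].X)
y = ℚ⟮x,y⟯.embed ℚ[x][y].X

y#0 : y # 0#
y#0 = from-no (ℚ⟮x,y⟯.≃-dec y 0#)

y-x#0 : (y - x) # 0#
y-x#0 = from-no (ℚ⟮x,y⟯.≃-dec (y - x) 0#)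

y-1#0 : (y - 1#) # 0#
y-1#0 = from-no (ℚ⟮x,y⟯.≃-dec (y - 1#) 0#)

x[y-1]+1#0 : (x * (y - 1#) + 1#) # 0#
x[y-1]+1#0 = from-no (ℚ⟮x,y⟯.≃-dec (x * (y - 1#) + 1#) 0#)

x+y+1#0 : (x + y + 1#) # 0#
x+y+1#0 = from-no (ℚ⟮x,y⟯.≃-dec (x + y + 1#) 0#)

xy+1#0 : (x * y + 1#) # 0#
xy+1#0 = from-no (ℚ⟮x,y⟯.≃-dec (x * y + 1#) 0#)

module Triangles (n : ℕ) (rk : Tri n → ℕ) (μ : Tri n → Tri n → ℤ) where

  open FiniteLattice (Hoch n) using (elements)

  M : RationalFunction → RationalFunction → RationalFunction
  M s t = ∑ elements λ u → ∑ elements λ v → μ u v · (s ^ rk u * t ^ rk v)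

  F : RationalFunction
  F = y ^ n * M ((y + 1#) / (y - x) ⟨ y-x#0 ⟩) ((y - x) / y ⟨ y#0 ⟩)

  H : RationalFunction
  H = (x * (y - 1#) + 1#) ^ n
    * M (y / (y - 1#) ⟨ y-1#0 ⟩) ((x * (y - 1#)) / (x * (y - 1#) + 1#) ⟨ x[y-1]+1#0 ⟩)

{-# OPTIONS --safe #-}
module Submission where

open import Defs hiding
  ( x; y; _≈_; _#_; _+_; _*_; _-_; 0#; 1#; _^_; _·_; _⁻¹⟨_⟩; _/_⟨_⟩; _⟨_⟩^_; ∑
  ; y#0; y-x#0; y-1#0; x[y-1]+1#0; x+y+1#0; xy+1#0 )
open import Algebra.Apartness using (HeytingField)
open import Algebra.Bundles using (CommutativeRing)
import Algebra.Properties.CommutativeSemiring.Exp as CommutativeSemiringExp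
import Algebra.Properties.Ring as RingProperties
import Algebra.Properties.Semiring.Mult as SemiringMult
import Algebra.Solver.Ring.NaturalCoefficients.Default as SemiringSolver
open import Data.Bool.Base using (true; false; if_then_else_)
open import Data.Empty using (⊥)
open import Data.Fin.Base as Fin using (Fin; zero; suc; toℕ)
open import Data.Fin.Patterns using (0F; 1F; 2F)
import Data.Fin.Properties as Finₚ
open import Data.Integer.Base using (ℤ; +_; -[1+_]; 0ℤ)
import Data.Integer.Base as ℤ
import Data.Integer.Properties as ℤₚ
open import Data.Irrelevant using ([_])
open import Data.List.Base using (List; []; _∷_; _++_; foldr; filter; map)
open import Data.List.Membership.Propositional using (_∈_)
open import Data.List.Membership.Propositional.Properties using (∈-filter⁺; ∈-filter⁻)
open import Data.List.Relation.Unary.All as All using (All)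
open import Data.List.Relation.Unary.AllPairs using (_∷_)
open import Data.List.Relation.Unary.Any using (here; there)
open import Data.List.Relation.Unary.Unique.Propositional using (Unique)
open import Data.Nat.Base using (ℕ; zero; suc; z≤n; s≤s)
import Data.Nat.Base as ℕ
import Data.Nat.Properties as ℕₚ
open import Data.Product.Base using (∃; _×_; _,_; proj₁; proj₂)
open import Data.Refinement using (value; _,_)
open import Data.Refinement.Properties using (value-injective)
open import Data.Sum.Base using (_⊎_; inj₁; inj₂; [_,_]′)
open import Data.Unit.Base using (⊤; tt)
open import Data.Vec.Base using ([]; _∷_; lookup; replicate; tabulate)
open import Data.Vec.Properties using (lookup∘tabulate; lookup-zipWith)
import Data.Vec.Relation.Binary.Pointwise.Extensional as Ext
open import Data.Vec.Relation.Binary.Pointwise.Inductive as Pointwise using (Pointwise; []; _∷_)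
open import Function.Base using (_∘_; case_of_)
open import Function.Bundles using (_⇔_; mk⇔; Equivalence)
open import Level using (0ℓ)
open import Relation.Binary.Core using (Rel)
open import Relation.Binary.Definitions using (Decidable; DecidableEquality; Reflexive; Transitive)
open import Relation.Binary.Lattice.Structures using (IsLattice)
open import Relation.Binary.PropositionalEquality as ≡ using (_≡_; _≢_; cong; cong₂; subst; subst₂)
import Relation.Binary.Reasoning.Setoid as SetoidReasoning
open import Relation.Nullary using (¬_; Dec; yes; no; contradiction)
open import Relation.Nullary.Decidable
  using (does; _×-dec_; _→-dec_; _⊎-dec_; ¬?; dec-true; dec-false; decidable-stable; does-⇔)
import Relation.Unary as U

-- In the triword u write a_i for 1…10…0 with i ones and b_i for the word whose
-- only nonzero entry is a 2 at position i.  The core labels of u are the b_i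
-- with u_i = 2, and the a_i for which u has a last 1 and only 2s from there up
-- to position i.  Hence u ⊑ v iff every 2 of u is a 2 of v and, if u_1 = 1,
-- every entry of v is a 2 or the entry of u; and rk u counts the 2s of u, plus
-- one if u_1 = 1.
--
-- The Möbius function need not be computed.  If g satisfies
-- Σ_{v ⊒ w} g(v) = t^{rk w} for all w, then Σ_v μ(u,v) t^{rk v} = g(u), so that
-- M(s,t) = Σ_u s^{rk u} g(u).  Let q = 1 − t and let W(u) be the product over
-- the positions i > 1 of t where u_i = 2 and of q elsewhere.  Then g(u) = t W(u)
-- if u_1 = 1, and g(u) = (1 − c t) W(u) if u_1 = 0, where c is the number of
-- triwords with first entry 1 and the same 2s as u.  Summing over u gives, with
-- σ = st + q, M(s,t) = σ^{n−2} (σ² + (n−1) q (st − t)).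

-- The three entry values, and last positions with a given property.

≢0⇒≢1⇒≡2 : ∀ {a : Fin 3} → a ≢ 0F → a ≢ 1F → a ≡ 2F
≢0⇒≢1⇒≡2 {0F} a≢0 _   = contradiction ≡.refl a≢0
≢0⇒≢1⇒≡2 {1F} _   a≢1 = contradiction ≡.refl a≢1
≢0⇒≢1⇒≡2 {2F} _   _   = ≡.refl

≢0⇒≢2⇒≡1 : ∀ {a : Fin 3} → a ≢ 0F → a ≢ 2F → a ≡ 1F
≢0⇒≢2⇒≡1 {0F} a≢0 _   = contradiction ≡.refl a≢0
≢0⇒≢2⇒≡1 {1F} _   _   = ≡.refl
≢0⇒≢2⇒≡1 {2F} _   a≢2 = contradiction ≡.refl a≢2

≢0⇒1≤ : ∀ {a : Fin 3} → a ≢ 0F → Fin._≤_ {3} {3} 1F a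
≢0⇒1≤ {0F}    a≢0 = contradiction ≡.refl a≢0
≢0⇒1≤ {suc _} _   = s≤s z≤n

-- The search in the tail comes before the test at position 0, so that a later witness is always
-- preferred.
greatest : ∀ {m} {P : Fin m → Set} → U.Decidable P → ∃ P → ∃ λ i → P i × ∀ k → i Fin.< k → ¬ P k
greatest {suc m} P? (i , p) with Finₚ.any? (P? ∘ suc)
... | yes ∃p = let i , p , last = greatest (P? ∘ suc) ∃p in
  suc i , p , λ { (suc k) (s≤s i<k) → last k i<k }
... | no  ∄p with i
... | zero  = zero , p , λ { (suc k) _ q → ∄p (k , q) }
... | suc i = contradiction (i , p) ∄p

-- Nuclei and cover relations in a finite lattice.

module FiniteLatticeProperties (L : FiniteLattice) where

  open FiniteLattice L
  open CoreLabelOrder L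
  open IsLattice isLattice public
    using (antisym; x≤x∨y; y≤x∨y; ∨-least; x∧y≤x; x∧y≤y; ∧-greatest)
    renaming (refl to ≤-refl; trans to ≤-trans)

  private
    ⋀-≤ : ∀ {c cs} a → c ∈ cs → foldr _∧_ a cs ≤ c
    ⋀-≤ a (here ≡.refl) = x∧y≤x _ _
    ⋀-≤ a (there c∈) = ≤-trans (x∧y≤y _ _) (⋀-≤ a c∈)

    ≤-⋀ : ∀ {w} a cs → w ≤ a → (∀ {c} → c ∈ cs → w ≤ c) → w ≤ foldr _∧_ a cs
    ≤-⋀ a []       w≤a w≤cs = w≤a
    ≤-⋀ a (c ∷ cs) w≤a w≤cs = ∧-greatest (w≤cs (here ≡.refl)) (≤-⋀ a cs w≤a (w≤cs ∘ there))

  nucleus-≤ : ∀ {a c} → c ⋖ a → nucleus a ≤ c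
  nucleus-≤ {a} c⋖a = ⋀-≤ a (∈-filter⁺ (_⋖? a) (complete _) c⋖a)

  nucleus-≤-self : ∀ a → nucleus a ≤ a
  nucleus-≤-self a = ⋀-≤-self (filter (_⋖? a) elements)
    where
    ⋀-≤-self : ∀ cs → foldr _∧_ a cs ≤ a
    ⋀-≤-self []       = ≤-refl
    ⋀-≤-self (c ∷ cs) = ≤-trans (x∧y≤y _ _) (⋀-≤-self cs)

  ≤-nucleus : ∀ {a} w → w ≤ a → (∀ c → c ⋖ a → w ≤ c) → w ≤ nucleus a
  ≤-nucleus {a} w w≤a w≤c = ≤-⋀ a _ w≤a λ c∈ → w≤c _ (proj₂ (∈-filter⁻ (_⋖? a) {xs = elements} c∈))

  -- `b ∨ e` lies above `b`, differs from `b` because `e` is not below `b`, and lies below `b′`; a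
  -- cover leaves only `b′`.
  ⋖⇒∨≡ : ∀ {b b′} e → b ⋖ b′ → e ≤ b′ → ¬ e ≤ b → b ∨ e ≡ b′
  ⋖⇒∨≡ {b} {b′} e ((b≤b′ , _) , nothing) e≤b′ e≰b with (b ∨ e) ≟ b′
  ... | yes eq = eq
  ... | no neq = contradiction
    (b ∨ e , (x≤x∨y b e , λ eq → e≰b (subst (e ≤_) (≡.sym eq) (y≤x∨y b e))) , (∨-least b≤b′ e≤b′ , neq))
    nothing

-- The core labels of a triword.

module _ {N : ℕ} where

  private
    n : ℕ
    n = suc N

  open FiniteLattice (Hoch n) using (_≤_; _∨_)
  open FiniteLatticeProperties (Hoch n)
  open CoreLabelOrder (Hoch n)

  fromEntries : (f : Fin n → Fin 3) → f zero ≢ 2F →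
                (∀ i j → i Fin.< j → f i ≡ 0F → f j ≢ 1F) → Tri n
  fromEntries f f0≢2 no01 = tabulate f , [ mk
      (λ { zero _ e → f0≢2 (≡.trans (≡.sym (lookup∘tabulate f zero)) e) })
      (λ i j i<j e e′ → no01 i j i<j (≡.trans (≡.sym (lookup∘tabulate f i)) e) (≡.trans (≡.sym (lookup∘tabulate f j)) e′)) ]

  entry-fromEntries : ∀ f p q i → entry (fromEntries f p q) i ≡ f i
  entry-fromEntries f _ _ = lookup∘tabulate f

  entry-ext : ∀ {u v : Tri n} → (∀ i → entry u i ≡ entry v i) → u ≡ v
  entry-ext e = antisym (ℕₚ.≤-reflexive ∘ cong toℕ ∘ e) (ℕₚ.≤-reflexive ∘ cong toℕ ∘ ≡.sym ∘ e)

  first-entry≢2 : (u : Tri n) → entry u zero ≢ 2F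
  first-entry≢2 u = IsTriword.first≢2 (isTriword u) zero ≡.refl

  no-1-after-0 : ∀ (u : Tri n) {i j} → i Fin.< j → entry u i ≡ 0F → entry u j ≢ 1F
  no-1-after-0 u = IsTriword.no-0-1 (isTriword u) _ _

  -- An entry of the join is one of the two entries, so where `b` falls short it comes from `c`.
  -- This is how every `c` with `b ∨ c ≡ b′` is bounded below by the label.
  entry-∨ : ∀ (b c {b′} : Tri n) {i} → b ∨ c ≡ b′ → entry b i ≢ entry b′ i → entry c i ≡ entry b′ i
  entry-∨ b c {i = i} ≡.refl b≢ with ⊔-sel (entry b i) (entry c i)
  ... | inj₁ e = contradiction (≡.sym (≡.trans (lookup-zipWith _⊔ᶠ_ i (value b) (value c)) e)) b≢
  ... | inj₂ e = ≡.sym (≡.trans (lookup-zipWith _⊔ᶠ_ i (value b) (value c)) e)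

  -- The words a_m. As positions start at 0, the one whose last 1 is at position `i` is
  -- `ones (suc (toℕ i))`, which covers `ones (toℕ i)`.
  ones : ℕ → Tri n
  ones m = fromEntries f first no01
    module Ones where
    f : Fin n → Fin 3
    f k = if does (toℕ k ℕₚ.<? m) then 1F else 0F
    f< : ∀ k → toℕ k ℕ.< m → f k ≡ 1F
    f< k k<m = cong (if_then 1F else 0F) (dec-true (toℕ k ℕₚ.<? m) k<m)
    f≥ : ∀ k → m ℕ.≤ toℕ k → f k ≡ 0F
    f≥ k m≤k = cong (if_then 1F else 0F) (dec-false (toℕ k ℕₚ.<? m) (ℕₚ.≤⇒≯ m≤k))
    first : f zero ≢ 2F
    first with 0 ℕ.<ᵇ m
    ... | true  = λ ()
    ... | false = λ ()
    no01 : ∀ i j → i Fin.< j → f i ≡ 0F → f j ≢ 1F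
    no01 i j i<j fi≡0 fj≡1 with ℕₚ.<-≤-connex (toℕ i) m | ℕₚ.<-≤-connex (toℕ j) m
    ... | inj₁ i<m | _        = contradiction (≡.trans (≡.sym (f< i i<m)) fi≡0) λ ()
    ... | inj₂ m≤i | inj₁ j<m = ℕₚ.<⇒≱ (ℕₚ.<-trans i<j j<m) m≤i
    ... | inj₂ _   | inj₂ m≤j = contradiction (≡.trans (≡.sym (f≥ j m≤j)) fj≡1) λ ()

  entry-ones< : ∀ {m} i → toℕ i ℕ.< m → entry (ones m) i ≡ 1F
  entry-ones< {m} i i<m =
    ≡.trans (entry-fromEntries (Ones.f m) (Ones.first m) (Ones.no01 m) i) (Ones.f< m i i<m)

  entry-ones≥ : ∀ {m} i → m ℕ.≤ toℕ i → entry (ones m) i ≡ 0F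
  entry-ones≥ {m} i m≤i =
    ≡.trans (entry-fromEntries (Ones.f m) (Ones.first m) (Ones.no01 m) i) (Ones.f≥ m i m≤i)

  ones-≤ : ∀ {m} (u : Tri n) → (∀ i → toℕ i ℕ.< m → entry u i ≢ 0F) → ones m ≤ u
  ones-≤ {m} u u≢0 i with toℕ i ℕₚ.<? m
  ... | yes i<m = subst (Fin._≤ entry u i) (≡.sym (entry-ones< i i<m)) (≢0⇒1≤ (u≢0 i i<m))
  ... | no  i≮m = subst (Fin._≤ entry u i) (≡.sym (entry-ones≥ i (ℕₚ.≮⇒≥ i≮m))) z≤n

  ones-≤⁻ : ∀ {m} (u : Tri n) → ones m ≤ u → ∀ i → toℕ i ℕ.< m → entry u i ≢ 0F
  ones-≤⁻ u m≤u i i<m u≡0 with () ← subst₂ Fin._≤_ (entry-ones< i i<m) u≡0 (m≤u i)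

  -- The words b_i. No triword begins with 2, so `k` ranges over `Fin N` and the 2 stands at
  -- position `suc k`.
  two : Fin N → Tri n
  two k = fromEntries f (λ ()) no01
    module Two where
    f : Fin n → Fin 3
    f zero    = 0F
    f (suc j) = if does (j Finₚ.≟ k) then 2F else 0F
    ≢1 : ∀ j → f j ≢ 1F
    ≢1 (suc j) with does (j Finₚ.≟ k)
    ... | true  = λ ()
    ... | false = λ ()
    no01 : ∀ i j → i Fin.< j → f i ≡ 0F → f j ≢ 1F
    no01 _ j _ _ = ≢1 j

  entry-two : ∀ k i → entry (two k) i ≡ Two.f k i
  entry-two k = entry-fromEntries (Two.f k) (λ ()) (Two.no01 k)

  entry-two≡2 : ∀ k → entry (two k) (suc k) ≡ 2F
  entry-two≡2 k = ≡.trans (entry-two k (suc k)) (cong (if_then 2F else 0F) (dec-true (k Finₚ.≟ k) ≡.refl))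

  two-≤ : ∀ {k} (u : Tri n) → entry u (suc k) ≡ 2F → two k ≤ u
  two-≤ {k} u u≡2 zero    = subst (Fin._≤ entry u zero) (≡.sym (entry-two k zero)) z≤n
  two-≤ {k} u u≡2 (suc j) with j Finₚ.≟ k
  ... | yes ≡.refl = ℕₚ.≤-reflexive (cong toℕ (≡.trans (entry-two≡2 k) (≡.sym u≡2)))
  ... | no  j≢k  = subst (Fin._≤ entry u (suc j))
    (≡.sym (≡.trans (entry-two k (suc j)) (cong (if_then 2F else 0F) (dec-false (j Finₚ.≟ k) j≢k)))) z≤n

  two-≤⁻ : ∀ {k} (u : Tri n) → two k ≤ u → entry u (suc k) ≡ 2F
  two-≤⁻ {k} u k≤u = 2≤ (subst (Fin._≤ entry u (suc k)) (entry-two≡2 k) (k≤u (suc k)))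

  two≢ones : ∀ k m → two k ≢ ones (suc m)
  two≢ones k m e with () ← ≡.trans (≡.sym (entry-two k zero)) 
    (≡.trans (cong (λ u → entry u zero) e) (entry-ones< {suc m} zero (s≤s z≤n)))

  two-injective : ∀ {k l} → two k ≡ two l → k ≡ l
  two-injective {k} {l} e with k Finₚ.≟ l
  ... | yes k≡l = k≡l
  ... | no  k≢l with () ← ≡.trans (≡.sym (entry-two≡2 k)) (≡.trans (cong (λ u → entry u (suc k)) e)
                     (≡.trans (entry-two l (suc k)) (cong (if_then 2F else 0F) (dec-false (k Finₚ.≟ l) k≢l))))

  ones-injective : ∀ {i j : Fin n} → ones (suc (toℕ i)) ≡ ones (suc (toℕ j)) → i ≡ j
  ones-injective {i} {j} e = Finₚ.≤-antisym (le (≡.sym e)) (le e)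
    where
    le : ∀ {i j : Fin n} → ones (suc (toℕ i)) ≡ ones (suc (toℕ j)) → j Fin.≤ i
    le {i} {j} e with toℕ j ℕₚ.≤? toℕ i
    ... | yes j≤i = j≤i
    ... | no  j≰i with () ← ≡.trans (≡.sym (entry-ones≥ j (ℕₚ.≰⇒> j≰i)))
                       (≡.trans (cong (λ u → entry u j) e) (entry-ones< j ℕₚ.≤-refl))

  -- ones (suc (toℕ i)) labels a cover in the core of u exactly when LastOne≤ u i,
  -- that is, when u has a last 1 and only 2s from there up to position i.

  LastOne≤ : Tri n → Fin n → Set
  LastOne≤ u i = (∀ k → k Fin.≤ i → entry u k ≢ 0F) × (∀ k → i Fin.< k → entry u k ≢ 1F)

  data CoreLabel (u : Tri n) : Tri n → Set where
    two-label  : ∀ k → entry u (suc k) ≡ 2F → CoreLabel u (two k)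
    ones-label : ∀ i → LastOne≤ u i → CoreLabel u (ones (suc (toℕ i)))

  private
    -- Since `b ∨ e ≡ b′`, minimality of the label gives `j ≤ e`; only `e ≤ j` has to be supplied.
    ⋖-label : ∀ {b b′} e j → b ⋖ b′ → e ≤ b′ → ¬ e ≤ b → IsLabel b b′ j → e ≤ j → j ≡ e
    ⋖-label e j b⋖b′ e≤b′ e≰b (_ , least) e≤j = antisym (least e (⋖⇒∨≡ e b⋖b′ e≤b′ e≰b)) e≤j

    entry-between : ∀ {b b′ : Tri n} → b ⋖ b′ → ∃ λ i → entry b i ≢ entry b′ i
    entry-between {b} {b′} ((_ , b≢b′) , _) with Finₚ.any? (λ i → ¬? (entry b i Finₚ.≟ entry b′ i))
    ... | yes d = d
    ... | no ∄  = contradiction (entry-ext λ i → decidable-stable (entry b i Finₚ.≟ entry b′ i) λ ≢ → ∄ (i , ≢)) b≢b′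

    -- If ones (suc (toℕ i)) were not below the lower cover c, their join would be u,
    -- so c has the 1 of u at position k, hence no 0 at the positions up to i.
    nucleus≢0 : ∀ {u : Tri n} {i k} → ones (suc (toℕ i)) ≤ u → i Fin.< k → entry u k ≡ 1F →
                entry (nucleus u) i ≢ 0F
    nucleus≢0 {u} {i} {k} ≤u i<k u≡1 = ones-≤⁻ (nucleus u) (≤-nucleus (ones (suc (toℕ i))) ≤u below) i ℕₚ.≤-refl
      where
      below : ∀ c → c ⋖ u → ones (suc (toℕ i)) ≤ c
      below c c⋖u with FiniteLattice._≤?_ (Hoch n) (ones (suc (toℕ i))) c
      ... | yes ≤c = ≤c
      ... | no  ≰c with entry c k Finₚ.≟ entry u k
      ... | yes c≡u = ones-≤ c λ l l≤i c≡0 →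
        no-1-after-0 c (ℕₚ.≤-<-trans (ℕ.s≤s⁻¹ l≤i) i<k) c≡0 (≡.trans c≡u u≡1)
      ... | no  c≢u with () ← ≡.trans (≡.sym (entry-ones≥ k i<k))
        (≡.trans (entry-∨ c (ones (suc (toℕ i))) (⋖⇒∨≡ (ones (suc (toℕ i))) c⋖u ≤u ≰c) c≢u) u≡1)

  -- Some entry changes along `b ⋖ b′`. If an entry becomes 2 at `suc k`, the label is `two k`.
  -- Otherwise an entry `i` goes from 0 to 1; then `b′` has no 0 up to `i` and the label is
  -- `ones (suc (toℕ i))`. The nucleus is below `b`, hence 0 at `i`, so by `nucleus≢0` no 1 of `u`
  -- lies beyond `i`.
  Ψ⇒CoreLabel : ∀ {u j} → Ψ u j → CoreLabel u j
  Ψ⇒CoreLabel {u} {j} (b , b′ , u↓≤b , b⋖b′ , b′≤u , label@(b∨j≡b′ , _)) =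
    case-two (Finₚ.any? λ i → ¬? (entry b i Finₚ.≟ 2F) ×-dec (entry b′ i Finₚ.≟ 2F))
    where
    b≤b′ : b ≤ b′
    b≤b′ = proj₁ (proj₁ b⋖b′)

    case-two : Dec (∃ λ i → entry b i ≢ 2F × entry b′ i ≡ 2F) → CoreLabel u j
    case-two (yes (zero , _ , b′≡2)) = contradiction b′≡2 (first-entry≢2 b′)
    case-two (yes (suc k , b≢2 , b′≡2)) = subst (CoreLabel u)
      (≡.sym (⋖-label (two k) j b⋖b′ (two-≤ b′ b′≡2) (b≢2 ∘ two-≤⁻ b) label
        (two-≤ j (≡.trans (entry-∨ b j b∨j≡b′ λ b≡b′ → b≢2 (≡.trans b≡b′ b′≡2)) b′≡2))))
      (two-label k (two-≤⁻ u (≤-trans {two k} {b′} {u} (two-≤ b′ b′≡2) b′≤u)))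
    case-two (no ∄two) with i , b≢b′ ← entry-between b⋖b′ = subst (CoreLabel u)
      (≡.sym (⋖-label (ones (suc (toℕ i))) j b⋖b′ ones≤b′ (λ ≤b → ones-≤⁻ b ≤b i ℕₚ.≤-refl b≡0) label
        (no-zeros j (≡.trans (entry-∨ b j b∨j≡b′ b≢b′) (proj₂ b-b′)))))
      (ones-label i ((λ k k≤i → ones-≤⁻ u ones≤u k (s≤s k≤i)) , λ k i<k u≡1 →
        nucleus≢0 {u} ones≤u i<k u≡1 (≤0 (subst (entry (nucleus u) i Fin.≤_) b≡0 (u↓≤b i)))))
      where
      b-b′ : entry b i ≡ 0F × entry b′ i ≡ 1F
      b-b′ with entry b i in b≡ | entry b′ i in b′≡ | b≤b′ i
      ... | 0F | 0F | _ = contradiction ≡.refl b≢b′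
      ... | 0F | 1F | _ = ≡.refl , ≡.refl
      ... | 1F | 1F | _ = contradiction ≡.refl b≢b′
      ... | 1F | 0F | ()
      ... | 2F | 0F | ()
      ... | 2F | 1F | s≤s ()
      ... | 2F | 2F | _ = contradiction ≡.refl b≢b′
      ... | 0F | 2F | _ = contradiction (i , (λ b≡2 → contradiction (≡.trans (≡.sym b≡) b≡2) λ ()) , b′≡) ∄two
      ... | 1F | 2F | _ = contradiction (i , (λ b≡2 → contradiction (≡.trans (≡.sym b≡) b≡2) λ ()) , b′≡) ∄two
      b≡0 : entry b i ≡ 0F
      b≡0 = proj₁ b-b′
      no-zeros : ∀ (v : Tri n) → entry v i ≡ 1F → ones (suc (toℕ i)) ≤ v
      no-zeros v v≡1 = ones-≤ v λ k k≤i v≡0 →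
        case ℕₚ.m≤n⇒m<n∨m≡n (ℕ.s≤s⁻¹ k≤i) of λ where
          (inj₁ k<i) → no-1-after-0 v k<i v≡0 v≡1
          (inj₂ k≡i) → contradiction
            (≡.trans (≡.sym v≡1) (≡.trans (cong (entry v) (≡.sym (Finₚ.toℕ-injective k≡i))) v≡0)) λ ()
      ones≤b′ : ones (suc (toℕ i)) ≤ b′
      ones≤b′ = no-zeros b′ (proj₂ b-b′)
      ones≤u : ones (suc (toℕ i)) ≤ u
      ones≤u = ≤-trans {ones (suc (toℕ i))} {b′} {u} ones≤b′ b′≤u

  -- Covers obtained by changing a single entry.

  module _ (u : Tri n) (i : Fin n) (a : Fin 3) where

    replaceEntries : Fin n → Fin 3
    replaceEntries j = if does (j Finₚ.≟ i) then a else entry u j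

    replaceEntries-≡ : replaceEntries i ≡ a
    replaceEntries-≡ = cong (if_then a else entry u i) (dec-true (i Finₚ.≟ i) ≡.refl)

    replaceEntries-≢ : ∀ {j} → j ≢ i → replaceEntries j ≡ entry u j
    replaceEntries-≢ {j} j≢i = cong (if_then a else entry u j) (dec-false (j Finₚ.≟ i) j≢i)

    module _ (a≢2 : a ≢ 2F) (a≡0⇒ : a ≡ 0F → ∀ k → i Fin.< k → entry u k ≢ 1F)
             (a≡1⇒ : a ≡ 1F → ∀ k → k Fin.< i → entry u k ≢ 0F) where

      private
        cases : ∀ j → (j ≡ i × replaceEntries j ≡ a) ⊎ replaceEntries j ≡ entry u j
        cases j with j Finₚ.≟ i
        ... | yes j≡i = inj₁ (j≡i , ≡.refl)
        ... | no  _   = inj₂ ≡.refl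

        first : replaceEntries zero ≢ 2F
        first e =
          [ (λ (_ , ≡a) → a≢2 (≡.trans (≡.sym ≡a) e)) , (λ ≡u → first-entry≢2 u (≡.trans (≡.sym ≡u) e)) ]′ (cases zero)

        no01 : ∀ j k → j Fin.< k → replaceEntries j ≡ 0F → replaceEntries k ≢ 1F
        no01 j k j<k j≡0 k≡1 with cases j | cases k
        ... | inj₁ (≡.refl , _)  | inj₁ (≡.refl , _)  = ℕₚ.<-irrefl ≡.refl j<k
        ... | inj₁ (≡.refl , ≡a) | inj₂ ≡u          = a≡0⇒ (≡.trans (≡.sym ≡a) j≡0) k j<k (≡.trans (≡.sym ≡u) k≡1)
        ... | inj₂ ≡u          | inj₁ (≡.refl , ≡a) = a≡1⇒ (≡.trans (≡.sym ≡a) k≡1) j j<k (≡.trans (≡.sym ≡u) j≡0)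
        ... | inj₂ ≡u          | inj₂ ≡u′         = no-1-after-0 u j<k (≡.trans (≡.sym ≡u) j≡0) (≡.trans (≡.sym ≡u′) k≡1)

      replace : Tri n
      replace = fromEntries replaceEntries first no01

      entry-replace-≡ : entry replace i ≡ a
      entry-replace-≡ = ≡.trans (entry-fromEntries replaceEntries first no01 i) replaceEntries-≡

      entry-replace-≢ : ∀ j → j ≢ i → entry replace j ≡ entry u j
      entry-replace-≢ j j≢i = ≡.trans (entry-fromEntries replaceEntries first no01 j) (replaceEntries-≢ j≢i)

  private
    -- Anything strictly between `b` and `u` agrees with both away from `i`, so the cover condition
    -- concerns the entry at `i` alone.
    ⋖-single : ∀ {b u : Tri n} i → (∀ j → j ≢ i → entry b j ≡ entry u j) → entry b i Fin.< entry u i →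
               (∀ c → (∀ j → j ≢ i → entry c j ≡ entry u j) → entry b i Fin.< entry c i → ¬ (entry c i Fin.< entry u i)) →
               b ⋖ u
    ⋖-single {b} {u} i off b<u nothing = (b≤u , λ b≡u → ℕₚ.<-irrefl (cong (λ w → toℕ (entry w i)) b≡u) b<u) ,
      λ (c , (b≤c , b≢c) , (c≤u , c≢u)) → nothing c
        (λ j j≢i → Finₚ.≤-antisym (c≤u j) (subst (Fin._≤ entry c j) (off j j≢i) (b≤c j)))
        (Finₚ.≤∧≢⇒< (b≤c i) λ e → b≢c (antisym b≤c (c≤b c c≤u e)))
        (Finₚ.≤∧≢⇒< (c≤u i) λ e → c≢u (antisym c≤u (u≤c c b≤c e)))
      where
      b≤u : b ≤ u
      b≤u j with j Finₚ.≟ i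
      ... | yes ≡.refl = ℕₚ.<⇒≤ b<u
      ... | no  j≢i  = ℕₚ.≤-reflexive (cong toℕ (off j j≢i))
      c≤b : ∀ c → c ≤ u → entry b i ≡ entry c i → c ≤ b
      c≤b c c≤u e j with j Finₚ.≟ i
      ... | yes ≡.refl = ℕₚ.≤-reflexive (cong toℕ (≡.sym e))
      ... | no  j≢i  = subst (entry c j Fin.≤_) (≡.sym (off j j≢i)) (c≤u j)
      u≤c : ∀ c → b ≤ c → entry c i ≡ entry u i → u ≤ c
      u≤c c b≤c e j with j Finₚ.≟ i
      ... | yes ≡.refl = ℕₚ.≤-reflexive (cong toℕ (≡.sym e))
      ... | no  j≢i  = subst (Fin._≤ entry c j) (off j j≢i) (b≤c j)

    ⋖-suc : ∀ {b u : Tri n} i → (∀ j → j ≢ i → entry b j ≡ entry u j) → toℕ (entry u i) ≡ suc (toℕ (entry b i)) → b ⋖ u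
    ⋖-suc i off u≡1+b = ⋖-single i off (ℕₚ.≤-reflexive (≡.sym u≡1+b))
      λ c _ b<c c<u → ℕₚ.<⇒≱ c<u (subst (ℕ._≤ _) (≡.sym u≡1+b) b<c)

    -- Lowering a last 1 to 0 preserves `no-0-1`, as no 1 follows it, and no value lies between.
    one-cover : ∀ {u : Tri n} l → entry u l ≡ 1F → (∀ k → l Fin.< k → entry u k ≢ 1F) →
                ∃ λ b → b ⋖ u × entry b l ≡ 0F
    one-cover {u} l u≡1 last = replace u l 0F p q r , ⋖-suc l (entry-replace-≢ u l 0F p q r)
        (≡.trans (cong toℕ u≡1) (cong (suc ∘ toℕ) (≡.sym (entry-replace-≡ u l 0F p q r))))
      , entry-replace-≡ u l 0F p q r
      where
      p : 0F ≢ 2F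
      p ()
      q : 0F ≡ 0F → ∀ k → l Fin.< k → entry u k ≢ 1F
      q _ = last
      r : 0F ≡ 1F → ∀ k → k Fin.< l → entry u k ≢ 0F
      r ()

    -- The 2 at position i can be lowered to 1 unless a 0 precedes it, in which
    -- case the next lower value is 0.
    two-cover : ∀ {u : Tri n} i → entry u i ≡ 2F → ∃ λ b → b ⋖ u × entry b i ≢ 2F
    two-cover {u} i u≡2 with Finₚ.any? (λ k → (k Finₚ.<? i) ×-dec (entry u k Finₚ.≟ 0F))
    ... | no ∄0 = replace u i 1F p q r , ⋖-suc i (entry-replace-≢ u i 1F p q r)
          (≡.trans (cong toℕ u≡2) (cong (suc ∘ toℕ) (≡.sym (entry-replace-≡ u i 1F p q r))))
        , λ e → contradiction (≡.trans (≡.sym (entry-replace-≡ u i 1F p q r)) e) λ ()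
      where
      p : 1F ≢ 2F
      p ()
      q : 1F ≡ 0F → ∀ k → i Fin.< k → entry u k ≢ 1F
      q ()
      r : 1F ≡ 1F → ∀ k → k Fin.< i → entry u k ≢ 0F
      r _ k k<i u≡0 = ∄0 (k , k<i , u≡0)
    ... | yes (m , m<i , u≡0) = replace u i 0F p q r , ⋖-single i (entry-replace-≢ u i 0F p q r)
          (subst₂ Fin._<_ (≡.sym (entry-replace-≡ u i 0F p q r)) (≡.sym u≡2) (s≤s z≤n))
          (λ c off 0<c c<2 → no-1-after-0 c m<i (≡.trans (off m (λ m≡i → ℕₚ.<-irrefl (cong toℕ m≡i) m<i)) u≡0)
            (≡1 (subst (Fin._< entry c i) (entry-replace-≡ u i 0F p q r) 0<c) (subst (entry c i Fin.<_) u≡2 c<2)))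
        , λ e → contradiction (≡.trans (≡.sym (entry-replace-≡ u i 0F p q r)) e) λ ()
      where
      p : 0F ≢ 2F
      p ()
      q : 0F ≡ 0F → ∀ k → i Fin.< k → entry u k ≢ 1F
      q _ k i<k = no-1-after-0 u (ℕₚ.<-trans m<i i<k) u≡0
      r : 0F ≡ 1F → ∀ k → k Fin.< i → entry u k ≢ 0F
      r ()
      ≡1 : ∀ {a : Fin 3} → Fin._<_ {3} {3} 0F a → Fin._<_ {3} {3} a 2F → a ≡ 1F
      ≡1 {1F} _ _ = ≡.refl
      ≡1 {2F} _ (s≤s (s≤s ()))

  -- At the greatest position of a 1, `no-0-1` excludes any 0 before it.
  last-one : ∀ u → entry u zero ≡ 1F → ∃ λ l → entry u l ≡ 1F × LastOne≤ u l
  last-one u u≡1 with l , l≡1 , last ← greatest (λ i → entry u i Finₚ.≟ 1F) (zero , u≡1) =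
    l , l≡1 , (λ k k≤l k≡0 → case k Finₚ.≟ l of λ where
      (no  k≢l) → no-1-after-0 u (Finₚ.≤∧≢⇒< k≤l k≢l) k≡0 l≡1
      (yes k≡l) → contradiction (≡.trans (≡.sym k≡0) (≡.trans (cong (entry u) k≡l) l≡1)) λ ()) , last

  private
    -- Each 2 of `u` is lowered in the element given by `two-cover`, and the nucleus lies below that
    -- element.
    nucleus≢2 : ∀ (u : Tri n) k → entry (nucleus u) k ≢ 2F
    nucleus≢2 u k ↓≡2 with b , b⋖u , b≢2 ← two-cover {u} k (2≤ (subst (Fin._≤ entry u k) ↓≡2 (nucleus-≤-self u k)))
      = b≢2 (2≤ (subst (Fin._≤ entry b k) ↓≡2 (nucleus-≤ b⋖u k)))

    -- The nucleus has no 2. At the last 1 of `u`, at `l ≤ i`, it is 0, because `one-cover` lowers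
    -- that entry; beyond `l` a 1 is excluded by `no-0-1`, so the nucleus vanishes from `l` on.
    nucleus-≤-ones : ∀ {u} i → LastOne≤ u i → nucleus u ≤ ones (toℕ i)
    nucleus-≤-ones {u} i (≢0 , ≢1) k
      with l , u≡1 , (_ , last) ← last-one u (≢0⇒≢2⇒≡1 (≢0 zero z≤n) (first-entry≢2 u))
      with b , b⋖u , b≡0 ← one-cover {u} l u≡1 last
      with ℕₚ.<-≤-connex (toℕ k) (toℕ i)
    ... | inj₁ k<i = subst (entry (nucleus u) k Fin.≤_) (≡.sym (entry-ones< k k<i)) (≢2⇒≤1 (nucleus≢2 u k))
      where
      ≢2⇒≤1 : ∀ {a : Fin 3} → a ≢ 2F → Fin._≤_ {3} {3} a 1F
      ≢2⇒≤1 {0F} _   = z≤n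
      ≢2⇒≤1 {1F} _   = s≤s z≤n
      ≢2⇒≤1 {2F} a≢2 = contradiction ≡.refl a≢2
    ... | inj₂ i≤k = subst (Fin._≤ entry (ones (toℕ i)) k) (≡.sym nucleus≡0) z≤n
      where
      l≤i : l Fin.≤ i
      l≤i = ℕₚ.≮⇒≥ λ i<l → ≢1 l i<l u≡1
      nucleus-l≡0 : entry (nucleus u) l ≡ 0F
      nucleus-l≡0 = ≤0 (subst (entry (nucleus u) l Fin.≤_) b≡0 (nucleus-≤ b⋖u l))
      nucleus≡0 : entry (nucleus u) k ≡ 0F
      nucleus≡0 with l Finₚ.≟ k
      ... | yes ≡.refl = nucleus-l≡0
      ... | no  l≢k  = decidable-stable (_ Finₚ.≟ 0F) λ ≢0 → nucleus≢2 u k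
        (≢0⇒≢1⇒≡2 ≢0 (no-1-after-0 (nucleus u) (Finₚ.≤∧≢⇒< (ℕₚ.≤-trans l≤i i≤k) l≢k) nucleus-l≡0))

  -- A 2 is witnessed by the cover below `u` that lowers it. For `ones (suc (toℕ i))` the cover
  -- starts at `ones (toℕ i)`, which is above the nucleus by `nucleus-≤-ones`. For minimality, `c`
  -- must have a 1 at `i` and so no 0 before it.
  CoreLabel⇒Ψ : ∀ {u j} → CoreLabel u j → Ψ u j
  CoreLabel⇒Ψ {u} (two-label k u≡2) with b , b⋖u , b≢2 ← two-cover {u} (suc k) u≡2 =
    b , u , nucleus-≤ b⋖u , b⋖u , ≤-refl {u}
    , ⋖⇒∨≡ (two k) b⋖u (two-≤ u u≡2) (b≢2 ∘ two-≤⁻ b)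
    , λ c b∨c≡u → two-≤ c (≡.trans (entry-∨ b c b∨c≡u (λ e → b≢2 (≡.trans e u≡2))) u≡2)
  CoreLabel⇒Ψ {u} (ones-label i a) =
    b , b′ , nucleus-≤-ones {u} i a , b⋖b′ , ones-≤ u (λ k k≤i → proj₁ a k (ℕ.s≤s⁻¹ k≤i))
    , ⋖⇒∨≡ b′ b⋖b′ (≤-refl {b′}) (λ b′≤b → ones-≤⁻ b b′≤b i ℕₚ.≤-refl b≡0)
    , λ c b∨c≡b′ → ones-≤ c λ k k≤i c≡0 →
      let c≡1 = ≡.trans (entry-∨ b c b∨c≡b′ (λ e → contradiction (≡.trans (≡.sym b≡0) (≡.trans e b′≡1)) λ ())) b′≡1 in
      case k Finₚ.≟ i of λ where
        (yes ≡.refl) → contradiction (≡.trans (≡.sym c≡0) c≡1) λ ()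
        (no k≢i) → no-1-after-0 c (Finₚ.≤∧≢⇒< (ℕ.s≤s⁻¹ k≤i) k≢i) c≡0 c≡1
    where
    b b′ : Tri n
    b  = ones (toℕ i)
    b′ = ones (suc (toℕ i))
    b≡0 : entry b i ≡ 0F
    b≡0 = entry-ones≥ i ℕₚ.≤-refl
    b′≡1 : entry b′ i ≡ 1F
    b′≡1 = entry-ones< i ℕₚ.≤-refl
    b⋖b′ : b ⋖ b′
    b⋖b′ = ⋖-suc i off (≡.trans (cong toℕ b′≡1) (cong (suc ∘ toℕ) (≡.sym b≡0)))
      where
      off : ∀ j → j ≢ i → entry b j ≡ entry b′ j
      off j j≢i with ℕₚ.<-≤-connex (toℕ j) (toℕ i)
      ... | inj₁ j<i = ≡.trans (entry-ones< j j<i) (≡.sym (entry-ones< j (ℕₚ.m<n⇒m<1+n j<i)))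
      ... | inj₂ i≤j = ≡.trans (entry-ones≥ j i≤j) (≡.sym (entry-ones≥ j (Finₚ.≤∧≢⇒< i≤j (j≢i ∘ ≡.sym))))

  ⊑⇒⊆CoreLabel : ∀ u v → u ⊑ v → ∀ {j} → CoreLabel u j → CoreLabel v j
  ⊑⇒⊆CoreLabel u v u⊑v {j} l = Ψ⇒CoreLabel {v} {j} (u⊑v {j} (CoreLabel⇒Ψ {u} {j} l))

  ⊆CoreLabel⇒⊑ : ∀ u v → (∀ {j} → CoreLabel u j → CoreLabel v j) → u ⊑ v
  ⊆CoreLabel⇒⊑ u v u⊆v {j} Ψu = CoreLabel⇒Ψ {v} {j} (u⊆v (Ψ⇒CoreLabel {u} {j} Ψu))

-- The core label order read off the entries.

Keeps2 Extends : Fin 3 → Fin 3 → Set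
Keeps2  a b = a ≡ 2F → b ≡ 2F
Extends a b = b ≡ a ⊎ b ≡ 2F

infix 4 _⊆₂_ _⊴_ _⊑ʷ_

_⊆₂_ _⊴_ : ∀ {m} → Word m → Word m → Set
_⊆₂_ = Pointwise Keeps2
_⊴_  = Pointwise Extends

_⊆₂?_ : ∀ {m} (w w′ : Word m) → Dec (w ⊆₂ w′)
_⊆₂?_ = Pointwise.decidable λ a b → (a Finₚ.≟ 2F) →-dec (b Finₚ.≟ 2F)

_⊴?_ : ∀ {m} (w w′ : Word m) → Dec (w ⊴ w′)
_⊴?_ = Pointwise.decidable λ a b → (b Finₚ.≟ a) ⊎-dec (b Finₚ.≟ 2F)

-- Agrees with the core label order on triwords, whose first entry is 0 or 1.

_⊑ʷ_ : ∀ {m} → Word (suc m) → Word (suc m) → Set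
(0F ∷ w) ⊑ʷ (_  ∷ w′) = w ⊆₂ w′
(1F ∷ w) ⊑ʷ (1F ∷ w′) = w ⊴ w′
_        ⊑ʷ _         = ⊥

_⊑ʷ?_ : ∀ {m} (u v : Word (suc m)) → Dec (u ⊑ʷ v)
(0F ∷ w) ⊑ʷ? (_  ∷ w′) = w ⊆₂? w′
(1F ∷ w) ⊑ʷ? (0F ∷ w′) = no λ ()
(1F ∷ w) ⊑ʷ? (1F ∷ w′) = w ⊴? w′
(1F ∷ w) ⊑ʷ? (2F ∷ w′) = no λ ()
(2F ∷ w) ⊑ʷ? (_  ∷ w′) = no λ ()

private
  pointwise : ∀ {R : Fin 3 → Fin 3 → Set} {m} {w w′ : Word m} → (∀ i → R (lookup w i) (lookup w′ i)) → Pointwise R w w′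
  pointwise f = Ext.extensional⇒inductive (Ext.ext f)

  ⊴⇒⊆₂ : ∀ {m} {w w′ : Word m} → w ⊴ w′ → w ⊆₂ w′
  ⊴⇒⊆₂ []        = []
  ⊴⇒⊆₂ (e ∷ w⊴w′) = (λ a≡2 → [ (λ b≡a → ≡.trans b≡a a≡2) , (λ b≡2 → b≡2) ]′ e) ∷ ⊴⇒⊆₂ w⊴w′

-- IsTriword (0 ∷ w) and IsTriword (1 ∷ w), respectively.

No1 Tail : ∀ {m} → Word m → Set
No1 []       = ⊤
No1 (1F ∷ w) = ⊥
No1 (0F ∷ w) = No1 w
No1 (2F ∷ w) = No1 w
Tail []       = ⊤
Tail (0F ∷ w) = No1 w
Tail (1F ∷ w) = Tail w
Tail (2F ∷ w) = Tail w

no1? : ∀ {m} (w : Word m) → Dec (No1 w)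
no1? []       = yes tt
no1? (0F ∷ w) = no1? w
no1? (1F ∷ w) = no λ ()
no1? (2F ∷ w) = no1? w

tail? : ∀ {m} (w : Word m) → Dec (Tail w)
tail? []       = yes tt
tail? (0F ∷ w) = no1? w
tail? (1F ∷ w) = tail? w
tail? (2F ∷ w) = tail? w

No1⇒≢1 : ∀ {m} {w : Word m} → No1 w → ∀ i → lookup w i ≢ 1F
No1⇒≢1 {w = 0F ∷ w} p (suc i) = No1⇒≢1 {w = w} p i
No1⇒≢1 {w = 2F ∷ w} p (suc i) = No1⇒≢1 {w = w} p i

≢1⇒No1 : ∀ {m} (w : Word m) → (∀ i → lookup w i ≢ 1F) → No1 w
≢1⇒No1 []       f = tt
≢1⇒No1 (0F ∷ w) f = ≢1⇒No1 w (f ∘ suc)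
≢1⇒No1 (1F ∷ w) f = f zero ≡.refl
≢1⇒No1 (2F ∷ w) f = ≢1⇒No1 w (f ∘ suc)

private
  No01 : ∀ {m} → Word m → Set
  No01 w = ∀ i j → i Fin.< j → lookup w i ≡ 0F → lookup w j ≢ 1F

  No01-tail : ∀ {m a} {w : Word m} → No01 (a ∷ w) → No01 w
  No01-tail f i j i<j = f (suc i) (suc j) (s≤s i<j)

  No01-∷ : ∀ {m a} {w : Word m} → a ≢ 0F → No01 w → No01 (a ∷ w)
  No01-∷ a≢0 f zero    _       _         a≡0 = contradiction a≡0 a≢0
  No01-∷ _   f (suc i) (suc j) (s≤s i<j) = f i j i<j

  No01-0∷ : ∀ {m} {w : Word m} → No1 w → No01 (0F ∷ w)
  No01-0∷ {w = w} p _ zero    ()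
  No01-0∷ {w = w} p _ (suc j) _ _ = No1⇒≢1 {w = w} p j

  No01⇒Tail : ∀ {m} (w : Word m) → No01 w → Tail w
  No01⇒Tail []       f = tt
  No01⇒Tail (0F ∷ w) f = ≢1⇒No1 w λ j → f zero (suc j) (s≤s z≤n) ≡.refl
  No01⇒Tail (1F ∷ w) f = No01⇒Tail w (No01-tail f)
  No01⇒Tail (2F ∷ w) f = No01⇒Tail w (No01-tail f)

  Tail⇒No01 : ∀ {m} (w : Word m) → Tail w → No01 w
  Tail⇒No01 (0F ∷ w) p = No01-0∷ {w = w} p
  Tail⇒No01 (1F ∷ w) p = No01-∷ (λ ()) (Tail⇒No01 w p)
  Tail⇒No01 (2F ∷ w) p = No01-∷ (λ ()) (Tail⇒No01 w p)

No1⇒Tail : ∀ {m} (w : Word m) → No1 w → Tail w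
No1⇒Tail []       p = tt
No1⇒Tail (0F ∷ w) p = p
No1⇒Tail (2F ∷ w) p = No1⇒Tail w p

0∷-triword : ∀ {m} {w : Word m} → IsTriword (0F ∷ w) ⇔ No1 w
0∷-triword {w = w} = mk⇔
  (λ t → ≢1⇒No1 w λ j → IsTriword.no-0-1 t zero (suc j) (s≤s z≤n) ≡.refl)
  (λ p → mk (λ { zero _ () }) (No01-0∷ {w = w} p))

1∷-triword : ∀ {m} {w : Word m} → IsTriword (1F ∷ w) ⇔ Tail w
1∷-triword {w = w} = mk⇔
  (λ t → No01⇒Tail w (No01-tail (IsTriword.no-0-1 t)))
  (λ p → mk (λ { zero _ () }) (No01-∷ (λ ()) (Tail⇒No01 w p)))

-- The rank of a word and its growth along the order.

twos : ∀ {m} → Word m → ℕ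
twos []       = 0
twos (0F ∷ w) = twos w
twos (1F ∷ w) = twos w
twos (2F ∷ w) = suc (twos w)

-- On triwords the first entry is 0 or 1, so `toℕ a` adds one exactly when the word begins with 1.
rank : ∀ {m} → Word (suc m) → ℕ
rank (a ∷ w) = toℕ a ℕ.+ twos w

⊆₂⇒twos≤ : ∀ {m} {w w′ : Word m} → w ⊆₂ w′ → twos w ℕ.≤ twos w′
⊆₂⇒twos≤ [] = z≤n
⊆₂⇒twos≤ (_∷_ {x = 0F} {y = 0F} _ ps) = ⊆₂⇒twos≤ ps
⊆₂⇒twos≤ (_∷_ {x = 0F} {y = 1F} _ ps) = ⊆₂⇒twos≤ ps
⊆₂⇒twos≤ (_∷_ {x = 0F} {y = 2F} _ ps) = ℕₚ.m≤n⇒m≤1+n (⊆₂⇒twos≤ ps)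
⊆₂⇒twos≤ (_∷_ {x = 1F} {y = 0F} _ ps) = ⊆₂⇒twos≤ ps
⊆₂⇒twos≤ (_∷_ {x = 1F} {y = 1F} _ ps) = ⊆₂⇒twos≤ ps
⊆₂⇒twos≤ (_∷_ {x = 1F} {y = 2F} _ ps) = ℕₚ.m≤n⇒m≤1+n (⊆₂⇒twos≤ ps)
⊆₂⇒twos≤ (_∷_ {x = 2F} p ps) with ≡.refl ← p ≡.refl = s≤s (⊆₂⇒twos≤ ps)

-- An inclusion of finite sets, here of the positions of 2, is an equality once the larger set has
-- no more elements.
⊇₂-from-twos≥ : ∀ {m} {w w′ : Word m} → w ⊆₂ w′ → twos w′ ℕ.≤ twos w → w′ ⊆₂ w
⊇₂-from-twos≥ [] _ = []
⊇₂-from-twos≥ (_∷_ {x = 0F} {y = 0F} _ ps) ≤ = (λ ()) ∷ ⊇₂-from-twos≥ ps ≤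
⊇₂-from-twos≥ (_∷_ {x = 0F} {y = 1F} _ ps) ≤ = (λ ()) ∷ ⊇₂-from-twos≥ ps ≤
⊇₂-from-twos≥ (_∷_ {x = 0F} {y = 2F} _ ps) ≤ = contradiction (⊆₂⇒twos≤ ps) (ℕₚ.<⇒≱ ≤)
⊇₂-from-twos≥ (_∷_ {x = 1F} {y = 0F} _ ps) ≤ = (λ ()) ∷ ⊇₂-from-twos≥ ps ≤
⊇₂-from-twos≥ (_∷_ {x = 1F} {y = 1F} _ ps) ≤ = (λ ()) ∷ ⊇₂-from-twos≥ ps ≤
⊇₂-from-twos≥ (_∷_ {x = 1F} {y = 2F} _ ps) ≤ = contradiction (⊆₂⇒twos≤ ps) (ℕₚ.<⇒≱ ≤)
⊇₂-from-twos≥ (_∷_ {x = 2F} p ps) ≤ with ≡.refl ← p ≡.refl = (λ _ → ≡.refl) ∷ ⊇₂-from-twos≥ ps (ℕ.s≤s⁻¹ ≤)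

-- `w′` differs from `w` only by new 2s, and the second inclusion leaves none.
⊴-⊇₂⇒≡ : ∀ {m} {w w′ : Word m} → w ⊴ w′ → w′ ⊆₂ w → w ≡ w′
⊴-⊇₂⇒≡ []                []       = ≡.refl
⊴-⊇₂⇒≡ (inj₁ ≡.refl ∷ w⊴w′) (q ∷ w′⊆w) = cong (_ ∷_) (⊴-⊇₂⇒≡ w⊴w′ w′⊆w)
⊴-⊇₂⇒≡ (inj₂ ≡.refl ∷ w⊴w′) (q ∷ w′⊆w) = cong₂ _∷_ (q ≡.refl) (⊴-⊇₂⇒≡ w⊴w′ w′⊆w)

-- Without 1s an entry other than 2 is 0, so two entries that are not 2 agree.
No1-⊆₂⇒⊴ : ∀ {m} {w w′ : Word m} → No1 w → No1 w′ → w ⊆₂ w′ → w ⊴ w′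
No1-⊆₂⇒⊴ _ _ [] = []
No1-⊆₂⇒⊴ p q (_∷_ {x = 0F} {y = 0F} _ ps) = inj₁ ≡.refl ∷ No1-⊆₂⇒⊴ p q ps
No1-⊆₂⇒⊴ p q (_∷_ {x = 0F} {y = 2F} _ ps) = inj₂ ≡.refl ∷ No1-⊆₂⇒⊴ p q ps
No1-⊆₂⇒⊴ p q (_∷_ {x = 2F} {y = 0F} r ps) with () ← r ≡.refl
No1-⊆₂⇒⊴ p q (_∷_ {x = 2F} {y = 2F} _ ps) = inj₁ ≡.refl ∷ No1-⊆₂⇒⊴ p q ps

⊑ʷ⇒rank≤ : ∀ {m} {u v : Word (suc m)} → u ⊑ʷ v → rank u ℕ.≤ rank v
⊑ʷ⇒rank≤ {u = 0F ∷ w} {b  ∷ w′} w⊆w′ = ℕₚ.≤-trans (⊆₂⇒twos≤ w⊆w′) (ℕₚ.m≤n+m (twos w′) (toℕ b))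
⊑ʷ⇒rank≤ {u = 1F ∷ w} {1F ∷ w′} w⊴w′ = s≤s (⊆₂⇒twos≤ (⊴⇒⊆₂ w⊴w′))

-- Strictly larger elements have strictly larger rank; antisymmetry and the cover relations both
-- rest on this.
⊑ʷ-rank≥⇒≡ : ∀ {m} {u v : Word (suc m)} → IsTriword u → IsTriword v → u ⊑ʷ v → rank v ℕ.≤ rank u → u ≡ v
⊑ʷ-rank≥⇒≡ {u = 0F ∷ w} {0F ∷ w′} s t w⊆w′ ≤ = cong (0F ∷_)
  (⊴-⊇₂⇒≡ (No1-⊆₂⇒⊴ (Equivalence.to 0∷-triword s) (Equivalence.to 0∷-triword t) w⊆w′) (⊇₂-from-twos≥ w⊆w′ ≤))
⊑ʷ-rank≥⇒≡ {u = 0F ∷ w} {1F ∷ w′} s t w⊆w′ ≤ = contradiction (⊆₂⇒twos≤ w⊆w′) (ℕₚ.<⇒≱ ≤)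
⊑ʷ-rank≥⇒≡ {u = 0F ∷ w} {2F ∷ w′} s t w⊆w′ ≤ = contradiction ≡.refl (IsTriword.first≢2 t zero ≡.refl)
⊑ʷ-rank≥⇒≡ {u = 1F ∷ w} {1F ∷ w′} s t w⊴w′ ≤ = cong (1F ∷_)
  (⊴-⊇₂⇒≡ w⊴w′ (⊇₂-from-twos≥ (⊴⇒⊆₂ w⊴w′) (ℕ.s≤s⁻¹ ≤)))

remove-1s : ∀ {m} → Word m → Word m
remove-1s []       = []
remove-1s (0F ∷ w) = 0F ∷ remove-1s w
remove-1s (1F ∷ w) = 0F ∷ remove-1s w
remove-1s (2F ∷ w) = 2F ∷ remove-1s w

remove-1s-No1 : ∀ {m} (w : Word m) → No1 (remove-1s w)
remove-1s-No1 []       = tt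
remove-1s-No1 (0F ∷ w) = remove-1s-No1 w
remove-1s-No1 (1F ∷ w) = remove-1s-No1 w
remove-1s-No1 (2F ∷ w) = remove-1s-No1 w

remove-1s-⊆₂ : ∀ {m} (w : Word m) → remove-1s w ⊆₂ w
remove-1s-⊆₂ []       = []
remove-1s-⊆₂ (0F ∷ w) = (λ ()) ∷ remove-1s-⊆₂ w
remove-1s-⊆₂ (1F ∷ w) = (λ ()) ∷ remove-1s-⊆₂ w
remove-1s-⊆₂ (2F ∷ w) = (λ _ → ≡.refl) ∷ remove-1s-⊆₂ w

twos-remove-1s : ∀ {m} (w : Word m) → twos (remove-1s w) ≡ twos w
twos-remove-1s []       = ≡.refl
twos-remove-1s (0F ∷ w) = twos-remove-1s w
twos-remove-1s (1F ∷ w) = twos-remove-1s w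
twos-remove-1s (2F ∷ w) = cong suc (twos-remove-1s w)

-- Turning one 2 into 0 gives the predecessor for the induction on the rank.
remove-2 : ∀ {m k} (w : Word m) → No1 w → twos w ≡ suc k → ∃ λ w′ → No1 w′ × w′ ⊆₂ w × twos w′ ≡ k
remove-2 (0F ∷ w) p e = let w′ , p′ , w′⊆w , e′ = remove-2 w p e in 0F ∷ w′ , p′ , (λ ()) ∷ w′⊆w , e′
remove-2 (2F ∷ w) p e = 0F ∷ w , p , (λ ()) ∷ Pointwise.refl (λ e → e) , ℕₚ.suc-injective e

twos≡0⇒⊆₂ : ∀ {m} {w w′ : Word m} → twos w ≡ 0 → w ⊆₂ w′
twos≡0⇒⊆₂ {w = []}     {[]}     _ = []
twos≡0⇒⊆₂ {w = 0F ∷ w} {b ∷ w′} e = (λ ()) ∷ twos≡0⇒⊆₂ e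
twos≡0⇒⊆₂ {w = 1F ∷ w} {b ∷ w′} e = (λ ()) ∷ twos≡0⇒⊆₂ e
twos≡0⇒⊆₂ {w = 2F ∷ w} ()

-- Agreement of the two orders, and uniqueness of the rank function.

module _ {N : ℕ} where

  private
    n : ℕ
    n = suc N

  open CoreLabelOrder (Hoch n)

  -- A 2 of `u` is a label, hence a 2 of `v`. If `u` begins with 1, its last 1 at `l` gives a label
  -- that `v` shares: neither word has a 0 up to `l` or a 1 beyond `l`, so where neither entry is 2
  -- the two agree.
  ⊑⇒⊑ʷ : ∀ {u v} → u ⊑ v → value u ⊑ʷ value v
  ⊑⇒⊑ʷ {u@(a ∷ w , _)} {v@(b ∷ w′ , _)} u⊑v = compare a b ≡.refl ≡.refl
    where
    keeps2 : ∀ k → Keeps2 (lookup w k) (lookup w′ k)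
    keeps2 k w≡2 = keeps2′ (⊑⇒⊆CoreLabel u v (λ {j} → u⊑v {j}) (two-label k w≡2)) ≡.refl
      where
      keeps2′ : ∀ {j} → CoreLabel v j → j ≡ two k → lookup w′ k ≡ 2F
      keeps2′ (two-label l w′≡2) e = subst (λ l → lookup w′ l ≡ 2F) (two-injective e) w′≡2
      keeps2′ (ones-label i _)   e = contradiction (≡.sym e) (two≢ones k (toℕ i))
    lastOne : ∀ i → LastOne≤ u i → LastOne≤ v i
    lastOne i a = lastOne′ (⊑⇒⊆CoreLabel u v (λ {j} → u⊑v {j}) (ones-label i a)) ≡.refl
      where
      lastOne′ : ∀ {j} → CoreLabel v j → j ≡ ones (suc (toℕ i)) → LastOne≤ v i
      lastOne′ (two-label l _)  e = contradiction e (two≢ones l (toℕ i))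
      lastOne′ (ones-label l a) e = subst (LastOne≤ v) (ones-injective {i = l} {i} e) a
    compare : ∀ a′ b′ → a ≡ a′ → b ≡ b′ → (a′ ∷ w) ⊑ʷ (b′ ∷ w′)
    compare 0F b′ _ _ = pointwise keeps2
    compare 1F 0F ≡.refl ≡.refl = let l , _ , p = last-one u ≡.refl in contradiction ≡.refl (proj₁ (lastOne l p) zero z≤n)
    compare 1F 1F ≡.refl ≡.refl = let l , _ , p = last-one u ≡.refl in
      pointwise λ k → extends (suc k) (p , lastOne l p) (keeps2 k)
      where
      extends : ∀ {l} k → LastOne≤ u l × LastOne≤ v l → Keeps2 (entry u k) (entry v k) → Extends (entry u k) (entry v k)
      extends {l} k ((u≢0 , u≢1) , (v≢0 , v≢1)) keeps with ℕₚ.≤-<-connex (toℕ k) (toℕ l) | entry u k in u≡ | entry v k in v≡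
      ... | _        | 2F | _  = inj₂ (keeps ≡.refl)
      ... | _        | _  | 2F = inj₂ ≡.refl
      ... | _        | 0F | 0F = inj₁ ≡.refl
      ... | _        | 1F | 1F = inj₁ ≡.refl
      ... | inj₁ k≤l | 0F | _  = contradiction u≡ (u≢0 k k≤l)
      ... | inj₁ k≤l | 1F | 0F = contradiction v≡ (v≢0 k k≤l)
      ... | inj₂ l<k | 0F | 1F = contradiction v≡ (v≢1 k l<k)
      ... | inj₂ l<k | 1F | 0F = contradiction u≡ (u≢1 k l<k)
    compare 1F 2F ≡.refl ≡.refl = contradiction ≡.refl (first-entry≢2 v)
    compare 2F b′ ≡.refl ≡.refl = contradiction ≡.refl (first-entry≢2 u)

  -- A label `ones (suc (toℕ i))` says that certain entries avoid 0 or avoid 1, and an entry that is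
  -- kept or becomes 2 goes on avoiding them.
  ⊑ʷ⇒⊑ : ∀ {u v} → value u ⊑ʷ value v → u ⊑ v
  ⊑ʷ⇒⊑ {u} {v} u⊑v {j} = ⊆CoreLabel⇒⊑ u v transfer {j}
    where
    keeps2 : ∀ {a b} {w w′ : Word N} → (a ∷ w) ⊑ʷ (b ∷ w′) → ∀ k → Keeps2 (lookup w k) (lookup w′ k)
    keeps2 {0F}      w⊆w′ = Pointwise.lookup w⊆w′
    keeps2 {1F} {1F} w⊴w′ = Pointwise.lookup (⊴⇒⊆₂ w⊴w′)
    extends : ∀ {a b} {w w′ : Word N} → a ≢ 0F → (a ∷ w) ⊑ʷ (b ∷ w′) →
              ∀ k → Extends (lookup (a ∷ w) k) (lookup (b ∷ w′) k)
    extends {0F}      a≢0 _    _       = contradiction ≡.refl a≢0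
    extends {1F} {1F} _   _    zero    = inj₁ ≡.refl
    extends {1F} {1F} _   w⊴w′ (suc k) = Pointwise.lookup w⊴w′ k
    ¬two : ∀ {a b c} → Extends a b → a ≢ c → 2F ≢ c → b ≢ c
    ¬two (inj₁ ≡.refl) a≢c _   = a≢c
    ¬two (inj₂ ≡.refl) _   2≢c = 2≢c
    transfer : ∀ {j} → CoreLabel u j → CoreLabel v j
    transfer (two-label k u≡2) = two-label k (keeps2′ (value u) (value v) u⊑v u≡2)
      where
      keeps2′ : ∀ (u v : Word n) → u ⊑ʷ v → Keeps2 (lookup u (suc k)) (lookup v (suc k))
      keeps2′ (_ ∷ _) (_ ∷ _) u⊑v = keeps2 u⊑v k
    transfer (ones-label i (≢0 , ≢1)) = ones-label i
      ( (λ k k≤i → ¬two (extends′ (value u) (value v) (≢0 zero z≤n) u⊑v k) (≢0 k k≤i) λ ())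
      , (λ k i<k → ¬two (extends′ (value u) (value v) (≢0 zero z≤n) u⊑v k) (≢1 k i<k) λ ()))
      where
      extends′ : ∀ (u v : Word n) → lookup u zero ≢ 0F → u ⊑ʷ v → ∀ k → Extends (lookup u k) (lookup v k)
      extends′ (_ ∷ _) (_ ∷ _) = extends

  0∷ᵀ : ∀ w → No1 w → Tri n
  0∷ᵀ w p = 0F ∷ w , [ Equivalence.from 0∷-triword p ]

  private
    -- Rank grows strictly along the order, so there is no room between two consecutive ranks.
    covers : ∀ {u v} → value u ⊑ʷ value v → rank (value v) ≡ suc (rank (value u)) → Covers _⊑_ u v
    covers {u} {v} u⊑v e =
      ((λ {j} → ⊑ʷ⇒⊑ {u} {v} u⊑v {j}) , λ u≡v → ℕₚ.1+n≢n (≡.trans (≡.sym e) (cong (rank ∘ value) (≡.sym u≡v))))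
      , λ (c , u⊏c , c⊏v) → ℕₚ.<⇒≱ (strict u⊏c) (ℕ.s≤s⁻¹ (subst (rank (value c) ℕ.<_) e (strict c⊏v)))
      where
      strict : ∀ {a b} → Strict _⊑_ a b → rank (value a) ℕ.< rank (value b)
      strict {a} {b} (a⊑b , a≢b) = ℕₚ.≰⇒> λ ≤ →
        a≢b (value-injective (⊑ʷ-rank≥⇒≡ (isTriword a) (isTriword b) (⊑⇒⊑ʷ {a} {b} (λ {j} → a⊑b {j})) ≤))

  module _ {rk : Tri n → ℕ} (isRank : IsRank rk) where

    open IsRankFunction isRank

    private
      -- Induction along a chain of covers that removes one 2 at a time; a word `0F ∷ w` without 2s
      -- is below everything.
      rk-0∷ : ∀ k w p → twos w ≡ k → rk (0∷ᵀ w p) ≡ k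
      rk-0∷ zero    w p e = rank-least (0∷ᵀ w p) λ v {j} → ⊑ʷ⇒⊑ {0∷ᵀ w p} {v} (least (value v)) {j}
        where
        least : ∀ v → (0F ∷ w) ⊑ʷ v
        least (b ∷ w′) = twos≡0⇒⊆₂ e
      rk-0∷ (suc k) w p e with w′ , p′ , w′⊆w , e′ ← remove-2 w p e =
        ≡.trans (rank-covers (0∷ᵀ w′ p′) (0∷ᵀ w p)
                (covers {0∷ᵀ w′ p′} {0∷ᵀ w p} w′⊆w (≡.trans e (cong suc (≡.sym e′)))))
              (cong suc (rk-0∷ k w′ p′ e′))

    -- A word `1F ∷ w` covers `0F ∷ remove-1s w`, which has the same 2s; this accounts for the extra
    -- one.
    rk≡rank : ∀ u → rk u ≡ rank (value u)
    rk≡rank u@(0F ∷ w , [ _ ]) = rk-0∷ (twos w) w (Equivalence.to 0∷-triword (isTriword u)) ≡.refl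
    rk≡rank u@(1F ∷ w , [ _ ]) =
      let u′ = 0∷ᵀ (remove-1s w) (remove-1s-No1 w) in
      ≡.trans (rank-covers u′ u (covers {u′} {u} (remove-1s-⊆₂ w) (cong suc (≡.sym (twos-remove-1s w)))))
            (cong suc (rk-0∷ (twos w) (remove-1s w) (remove-1s-No1 w) (twos-remove-1s w)))
    rk≡rank u@(2F ∷ w , [ _ ]) = contradiction ≡.refl (first-entry≢2 u)

  ⊑-antisym : ∀ {u v} → u ⊑ v → v ⊑ u → u ≡ v
  ⊑-antisym {u} {v} u⊑v v⊑u = value-injective (⊑ʷ-rank≥⇒≡ (isTriword u) (isTriword v)
    (⊑⇒⊑ʷ {u} {v} (λ {j} → u⊑v {j})) (⊑ʷ⇒rank≤ (⊑⇒⊑ʷ {v} {u} (λ {j} → v⊑u {j}))))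

-- Finite sums and integer multiples over an arbitrary field.

module Sums {c ℓ₁ ℓ₂} (K : HeytingField c ℓ₁ ℓ₂) where

  open HeytingField K using (Carrier; _≈_; _#_; _+_; _*_; _-_; -_; 0#; 1#; #⇒invertible; isCommutativeRing)
  open FieldArithmetic K

  private
    R : CommutativeRing c ℓ₁
    R = record { isCommutativeRing = isCommutativeRing }

  open CommutativeRing R using
    ( setoid; refl; sym; trans; reflexive; +-cong; +-congˡ; +-congʳ; *-cong; *-congˡ; *-congʳ; -‿cong
    ; +-identityˡ; +-identityʳ; *-identityˡ; *-identityʳ; zeroˡ; zeroʳ; distribˡ; distribʳ; *-comm; +-assoc; +-comm
    ; -‿inverseˡ; -‿inverseʳ; semiring; ring; commutativeSemiring )
  open RingProperties ring using (-‿distribˡ-*; -‿distribʳ-*; -‿+-comm; -0#≈0#)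
  open SemiringMult semiring using (×-homo-+; ×-assoc-*; ×-congʳ) renaming (_×_ to _×ℕ_)
  open CommutativeSemiringExp commutativeSemiring using (^-distrib-*; ^-congˡ)
  open SetoidReasoning setoid
  module S = SemiringSolver commutativeSemiring
  open S using (_:=_; _:+_; _:*_)

  ∑-cong : ∀ {A : Set} (as : List A) {f g} → (∀ a → f a ≈ g a) → ∑ as f ≈ ∑ as g
  ∑-cong []       e = refl
  ∑-cong (a ∷ as) e = +-cong (e a) (∑-cong as e)

  ∑-zero : ∀ {A : Set} (as : List A) {f} → (∀ a → f a ≈ 0#) → ∑ as f ≈ 0#
  ∑-zero []       e = refl
  ∑-zero (a ∷ as) e = trans (+-cong (e a) (∑-zero as e)) (+-identityˡ 0#)

  ∑-+ : ∀ {A : Set} (as : List A) (f g : A → Carrier) → ∑ as (λ a → f a + g a) ≈ ∑ as f + ∑ as g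
  ∑-+ []       f g = sym (+-identityˡ 0#)
  ∑-+ (a ∷ as) f g = trans (+-congˡ (∑-+ as f g))
    (S.solve 4 (λ p q r s → (p :+ q) :+ (r :+ s) := (p :+ r) :+ (q :+ s)) refl (f a) (g a) (∑ as f) (∑ as g))

  ∑-*ˡ : ∀ {A : Set} (as : List A) k (f : A → Carrier) → ∑ as (λ a → k * f a) ≈ k * ∑ as f
  ∑-*ˡ []       k f = sym (zeroʳ k)
  ∑-*ˡ (a ∷ as) k f = trans (+-congˡ (∑-*ˡ as k f)) (sym (distribˡ k (f a) (∑ as f)))

  ∑-swap : ∀ {A B : Set} (as : List A) (bs : List B) (f : A → B → Carrier) →
           ∑ as (λ a → ∑ bs (f a)) ≈ ∑ bs (λ b → ∑ as (λ a → f a b))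
  ∑-swap []       bs f = sym (∑-zero bs λ _ → refl)
  ∑-swap (a ∷ as) bs f = trans (+-congˡ (∑-swap as bs f)) (sym (∑-+ bs (f a) _))

  ∑-++ : ∀ {A : Set} (as bs : List A) (f : A → Carrier) → ∑ (as ++ bs) f ≈ ∑ as f + ∑ bs f
  ∑-++ []       bs f = sym (+-identityˡ _)
  ∑-++ (a ∷ as) bs f = trans (+-congˡ (∑-++ as bs f)) (sym (+-assoc _ _ _))

  ∑-map : ∀ {A B : Set} (h : A → B) as (f : B → Carrier) → ∑ (map h as) f ≈ ∑ as (f ∘ h)
  ∑-map h []       f = refl
  ∑-map h (a ∷ as) f = +-congˡ (∑-map h as f)

  -- As only `does` is used, the indicators of `_⊆₂?_` and `_⊴?_` on words `a ∷ w` compute entry by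
  -- entry, which the recursive sums below exploit.
  χ : ∀ {P : Set} → Dec P → Carrier → Carrier
  χ P? a = if does P? then a else 0#

  χ-true : ∀ {P : Set} (P? : Dec P) {a} → P → χ P? a ≈ a
  χ-true P? p = reflexive (≡.cong (if_then _ else 0#) (dec-true P? p))

  χ-false : ∀ {P : Set} (P? : Dec P) {a} → ¬ P → χ P? a ≈ 0#
  χ-false P? ¬p = reflexive (≡.cong (if_then _ else 0#) (dec-false P? ¬p))

  χ-cong : ∀ {P : Set} (P? : Dec P) {a b} → (P → a ≈ b) → χ P? a ≈ χ P? b
  χ-cong P? e with P?
  ... | yes p = e p
  ... | no  _ = refl

  χ-zero : ∀ {P : Set} (P? : Dec P) {a} → a ≈ 0# → χ P? a ≈ 0#
  χ-zero P? e with does P?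
  ... | true  = e
  ... | false = refl

  χ-*ˡ : ∀ {P : Set} (P? : Dec P) k a → χ P? (k * a) ≈ k * χ P? a
  χ-*ˡ P? k a with does P?
  ... | true  = refl
  ... | false = sym (zeroʳ k)

  χ-+ : ∀ {P : Set} (P? : Dec P) a b → χ P? (a + b) ≈ χ P? a + χ P? b
  χ-+ P? a b with does P?
  ... | true  = refl
  ... | false = sym (+-identityˡ 0#)

  χ-⇔ : ∀ {P : Set} (P? : Dec P) {Q : Set} {a} (Q? : Dec Q) → P ⇔ Q → χ P? a ≈ χ Q? a
  χ-⇔ P? Q? P⇔Q = reflexive (≡.cong (if_then _ else 0#) (does-⇔ P⇔Q P? Q?))

  ∑-filter : ∀ {A : Set} {P : A → Set} (P? : ∀ a → Dec (P a)) as (f : A → Carrier) →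
             ∑ (filter P? as) f ≈ ∑ as (λ a → χ (P? a) (f a))
  ∑-filter P? []       f = refl
  ∑-filter P? (a ∷ as) f with does (P? a)
  ... | true  = +-congˡ (∑-filter P? as f)
  ... | false = trans (∑-filter P? as f) (sym (+-identityˡ _))

  ∑-δ : ∀ {A : Set} (_≟_ : DecidableEquality A) {as} → Unique as → ∀ {a} → a ∈ as → ∀ (f : A → Carrier) →
        ∑ as (λ b → χ (a ≟ b) (f b)) ≈ f a
  ∑-δ _≟_ {a ∷ as} (a∉ ∷ _) (here ≡.refl) f =
    trans (+-cong (χ-true (a ≟ a) ≡.refl) (vanish a∉)) (+-identityʳ _)
    where
    vanish : ∀ {bs} → All (a ≢_) bs → ∑ bs (λ b → χ (a ≟ b) (f b)) ≈ 0#
    vanish All.[]             = refl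
    vanish (a≢b All.∷ a∉bs) = trans (+-cong (χ-false (a ≟ _) a≢b) (vanish a∉bs)) (+-identityˡ 0#)
  ∑-δ _≟_ {b ∷ as} (b∉ ∷ as!) (there a∈) f =
    trans (+-cong (χ-false (_ ≟ b) λ { ≡.refl → All.lookup b∉ a∈ ≡.refl }) (∑-δ _≟_ as! a∈ f)) (+-identityˡ _)

  -- Turns an integer multiple into a product, to which the semiring solver applies.
  ·-1-* : ∀ z a → z · a ≈ (z · 1#) * a
  ·-1-* (+ n)    a = trans (×-congʳ n (sym (*-identityˡ a))) (sym (×-assoc-* n 1# a))
  ·-1-* -[1+ n ] a = trans (-‿cong (·-1-* (+ suc n) a)) (-‿distribˡ-* _ a)

  ⊖-· : ∀ m n a → (m ℤ.⊖ n) · a ≈ m ×ℕ a - n ×ℕ a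
  ⊖-· m       zero    a = sym (trans (+-congˡ -0#≈0#) (+-identityʳ _))
  ⊖-· zero    (suc n) a = sym (+-identityˡ _)
  ⊖-· (suc m) (suc n) a = begin
    (suc m ℤ.⊖ suc n) · a            ≡⟨ ≡.cong (_· a) (ℤₚ.[1+m]⊖[1+n]≡m⊖n m n) ⟩
    (m ℤ.⊖ n) · a                    ≈⟨ ⊖-· m n a ⟩
    m ×ℕ a - n ×ℕ a                  ≈⟨ +-identityˡ _ ⟨
    0# + (m ×ℕ a - n ×ℕ a)           ≈⟨ +-congʳ (-‿inverseʳ a) ⟨
    (a - a) + (m ×ℕ a - n ×ℕ a)
      ≈⟨ S.solve 4 (λ p q r s → (p :+ q) :+ (r :+ s) := (p :+ r) :+ (q :+ s)) refl a (- a) (m ×ℕ a) (- (n ×ℕ a)) ⟩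
    (a + m ×ℕ a) + (- a - n ×ℕ a)    ≈⟨ +-congˡ (-‿+-comm a (n ×ℕ a)) ⟩
    (a + m ×ℕ a) - (a + n ×ℕ a)      ∎

  ·-homo-+ : ∀ z w a → (z ℤ.+ w) · a ≈ z · a + w · a
  ·-homo-+ (+ m)    (+ n)    a = ×-homo-+ a m n
  ·-homo-+ (+ m)    -[1+ n ] a = ⊖-· m (suc n) a
  ·-homo-+ -[1+ m ] (+ n)    a = trans (⊖-· n (suc m) a) (+-comm _ _)
  ·-homo-+ -[1+ m ] -[1+ n ] a = trans (-‿cong (trans (+-congˡ (trans (×-homo-+ a (suc m) n) refl))
    (S.solve 3 (λ p q r → p :+ (q :+ r) := q :+ (p :+ r)) refl a (suc m ×ℕ a) (n ×ℕ a)))) (sym (-‿+-comm _ _))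

  inverseʳ : ∀ {a} (a#0 : a # 0#) → a * a ⁻¹⟨ a#0 ⟩ ≈ 1#
  inverseʳ a#0 = trans (*-congʳ (sym (trans (+-congˡ -0#≈0#) (+-identityʳ _)))) (proj₂ (proj₂ (#⇒invertible a#0)))

  inverseˡ : ∀ {a} (a#0 : a # 0#) → a ⁻¹⟨ a#0 ⟩ * a ≈ 1#
  inverseˡ a#0 = trans (*-comm _ _) (inverseʳ a#0)

  cancel-/ : ∀ {a b} (b#0 : b # 0#) → b * (a / b ⟨ b#0 ⟩) ≈ a
  cancel-/ {a} {b} b#0 = trans (S.solve 3 (λ a b i → b :* (a :* i) := a :* (b :* i)) refl a b (b ⁻¹⟨ b#0 ⟩))
    (trans (*-congˡ (inverseʳ b#0)) (*-identityʳ a))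

  minus-plus : ∀ a b → (a - b) + b ≈ a
  minus-plus a b = trans (+-assoc a (- b) b) (trans (+-congˡ (-‿inverseˡ b)) (+-identityʳ a))

  -- Möbius inversion with values in the field.

  module MöbiusInversion
    {A : Set} (elements : List A) (_≟_ : DecidableEquality A)
    (unique : Unique elements) (complete : ∀ a → a ∈ elements)
    {_⊑_ : Rel A 0ℓ} (_⊑?_ : Decidable _⊑_) (⊑-refl : Reflexive _⊑_) (⊑-trans : Transitive _⊑_)
    (⊑-antisym : ∀ {u v} → u ⊑ v → v ⊑ u → u ≡ v)
    {μ : A → A → ℤ} (isMöbius : IsMöbiusFunction elements _⊑?_ μ)
    where

    open IsMöbiusFunction isMöbius

    private
      ∑-ι : ∀ {u} ws → ∑ ws (λ w → μ u w · 1#) ≈ foldr (λ w s → μ u w ℤ.+ s) 0ℤ ws · 1#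
      ∑-ι []       = refl
      ∑-ι (w ∷ ws) = trans (+-congˡ (∑-ι ws)) (sym (·-homo-+ (μ _ w) (foldr (λ w s → μ _ w ℤ.+ s) 0ℤ ws) 1#))

      -- `μ u w` vanishes unless `u ⊑ w`, so that condition may be added to reach the interval.
      restrict : ∀ u v w → χ (w ⊑? v) (μ u w · 1#) ≈ χ ((u ⊑? w) ×-dec (w ⊑? v)) (μ u w · 1#)
      restrict u v w with u ⊑? w
      ... | yes _   = refl
      ... | no  u⋢w = χ-zero (w ⊑? v) (reflexive (≡.cong (_· 1#) (μ-outside u w u⋢w)))

      -- The defining relations of the Möbius function gathered into one. For `u ≡ v` antisymmetry
      -- leaves the single term `w ≡ u`; for `u ⋢ v` the interval is empty.
      μ-sum : ∀ u v → ∑ elements (λ w → χ (w ⊑? v) (μ u w · 1#)) ≈ χ (u ≟ v) 1#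
      μ-sum u v = trans (∑-cong elements (restrict u v)) (case (u ≟ v) (u ⊑? v))
        where
        case : (d : Dec (u ≡ v)) → Dec (u ⊑ v) → ∑ elements (λ w → χ ((u ⊑? w) ×-dec (w ⊑? v)) (μ u w · 1#)) ≈ χ d 1#
        case (yes ≡.refl) _ = trans (∑-cong elements λ w →
            trans (χ-⇔ ((u ⊑? w) ×-dec (w ⊑? v)) (u ≟ w)
                    (mk⇔ (λ (u⊑w , w⊑u) → ⊑-antisym u⊑w w⊑u) λ { ≡.refl → ⊑-refl , ⊑-refl }))
                  (χ-cong (u ≟ w) λ { ≡.refl → trans (reflexive (≡.cong (_· 1#) (μ-diagonal u))) (+-identityʳ 1#) }))
          (∑-δ _≟_ unique (complete u) (λ _ → 1#))
        case (no u≢v) (yes u⊑v) = begin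
          ∑ elements (λ w → χ ((u ⊑? w) ×-dec (w ⊑? v)) (μ u w · 1#))
            ≈⟨ ∑-filter (λ w → (u ⊑? w) ×-dec (w ⊑? v)) elements _ ⟨
          ∑ (interval elements _⊑?_ u v) (λ w → μ u w · 1#)
            ≈⟨ ∑-ι (interval elements _⊑?_ u v) ⟩
          foldr (λ w s → μ u w ℤ.+ s) 0ℤ (interval elements _⊑?_ u v) · 1#
            ≡⟨ ≡.cong (_· 1#) (μ-interval u v u⊑v u≢v) ⟩
          0# ∎
        case (no _) (no u⋢v) = ∑-zero elements λ w →
          χ-false ((u ⊑? w) ×-dec (w ⊑? v)) λ (u⊑w , w⊑v) → u⋢v (⊑-trans u⊑w w⊑v)

    -- Replace `h w` by its sum over the elements above `w`, exchange the summations and evaluate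
    -- the inner sum by `μ-sum`.
    inversion : ∀ {g h : A → Carrier} → (∀ w → ∑ elements (λ v → χ (w ⊑? v) (g v)) ≈ h w) →
                ∀ u → ∑ elements (λ w → (μ u w · 1#) * h w) ≈ g u
    inversion {g} {h} g⇒h u = begin
      ∑ elements (λ w → (μ u w · 1#) * h w)
        ≈⟨ ∑-cong elements (λ w → trans (*-congˡ (sym (g⇒h w))) (sym (∑-*ˡ elements _ _))) ⟩
      ∑ elements (λ w → ∑ elements λ v → (μ u w · 1#) * χ (w ⊑? v) (g v))
        ≈⟨ ∑-swap elements elements _ ⟩
      ∑ elements (λ v → ∑ elements λ w → (μ u w · 1#) * χ (w ⊑? v) (g v))
        ≈⟨ ∑-cong elements (λ v → trans (∑-cong elements λ w → move w v) (∑-*ˡ elements (g v) _)) ⟩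
      ∑ elements (λ v → g v * ∑ elements λ w → χ (w ⊑? v) (μ u w · 1#))
        ≈⟨ ∑-cong elements (λ v → trans (*-congˡ (μ-sum u v))
             (trans (sym (χ-*ˡ (u ≟ v) (g v) 1#)) (χ-cong (u ≟ v) λ _ → *-identityʳ (g v)))) ⟩
      ∑ elements (λ v → χ (u ≟ v) (g v))
        ≈⟨ ∑-δ _≟_ unique (complete u) g ⟩
      g u ∎
      where
      move : ∀ w v → (μ u w · 1#) * χ (w ⊑? v) (g v) ≈ g v * χ (w ⊑? v) (μ u w · 1#)
      move w v = trans (sym (χ-*ˡ (w ⊑? v) _ _)) (trans (χ-cong (w ⊑? v) λ _ → *-comm _ _) (χ-*ˡ (w ⊑? v) _ _))

  -- Sums over the words with `No1` and with `Tail`, by recursion along these predicates.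

  sumNo1 sumTail : ∀ m → (Word m → Carrier) → Carrier
  sumNo1  zero    f = f []
  sumNo1  (suc m) f = sumNo1 m (f ∘ (0F ∷_)) + sumNo1 m (f ∘ (2F ∷_))
  sumTail zero    f = f []
  sumTail (suc m) f = sumNo1 m (f ∘ (0F ∷_)) + (sumTail m (f ∘ (1F ∷_)) + sumTail m (f ∘ (2F ∷_)))

  private
    allWords : ∀ m → (Word m → Carrier) → Carrier
    allWords m = ∑ (words m)

    allWords-suc : ∀ m f → allWords (suc m) f ≈
      allWords m (f ∘ (0F ∷_)) + (allWords m (f ∘ (1F ∷_)) + allWords m (f ∘ (2F ∷_)))
    allWords-suc m f =
      trans (∑-++ (map (0F ∷_) (words m)) _ f) (+-cong (∑-map (0F ∷_) (words m) f)
        (trans (∑-++ (map (1F ∷_) (words m)) _ f) (+-cong (∑-map (1F ∷_) (words m) f)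
          (trans (∑-++ (map (2F ∷_) (words m)) [] f) (trans (+-identityʳ _) (∑-map (2F ∷_) (words m) f))))))

    allWords-No1 : ∀ m f → allWords m (λ w → χ (no1? w) (f w)) ≈ sumNo1 m f
    allWords-No1 zero    f = +-identityʳ _
    allWords-No1 (suc m) f = trans (allWords-suc m _) (+-cong (allWords-No1 m _)
      (trans (+-congʳ (∑-zero (words m) λ _ → refl)) (trans (+-identityˡ _) (allWords-No1 m _))))

    allWords-Tail : ∀ m f → allWords m (λ w → χ (tail? w) (f w)) ≈ sumTail m f
    allWords-Tail zero    f = +-identityʳ _
    allWords-Tail (suc m) f = trans (allWords-suc m _)
      (+-cong (allWords-No1 m _) (+-cong (allWords-Tail m _) (allWords-Tail m _)))

    ∑-select : ∀ {m} (ws : List (Word m)) f → ∑ (select ws) (f ∘ value) ≈ ∑ ws (λ w → χ (isTriword? w) (f w))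
    ∑-select []       f = refl
    ∑-select (w ∷ ws) f with isTriword? w
    ... | yes t = +-cong (sym (χ-true (isTriword? w) t)) (∑-select ws f)
    ... | no ¬t = trans (∑-select ws f) (sym (trans (+-congʳ (χ-false (isTriword? w) ¬t)) (+-identityˡ _)))

  -- After a first entry 0 or 1 the rest ranges over `No1` or `Tail`; words beginning with 2 drop
  -- out.
  ∑-Tri : ∀ m f → ∑ (select (words (suc m))) (f ∘ value) ≈ sumNo1 m (f ∘ (0F ∷_)) + sumTail m (f ∘ (1F ∷_))
  ∑-Tri m f = trans (∑-select (words (suc m)) f) (trans (allWords-suc m _) (+-cong
    (trans (∑-cong (words m) λ w → χ-⇔ (isTriword? (0F ∷ w)) (no1? w) 0∷-triword) (allWords-No1 m _))
    (trans (+-cong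
      (trans (∑-cong (words m) λ w → χ-⇔ (isTriword? (1F ∷ w)) (tail? w) 1∷-triword) (allWords-Tail m _))
      (∑-zero (words m) λ w → χ-false (isTriword? (2F ∷ w)) {f (2F ∷ w)} λ t → IsTriword.first≢2 t zero ≡.refl ≡.refl))
      (+-identityʳ _))))

  sumNo1-cong : ∀ m {f g} → (∀ w → f w ≈ g w) → sumNo1 m f ≈ sumNo1 m g
  sumNo1-cong zero    e = e []
  sumNo1-cong (suc m) e = +-cong (sumNo1-cong m (e ∘ (0F ∷_))) (sumNo1-cong m (e ∘ (2F ∷_)))

  sumTail-cong : ∀ m {f g} → (∀ w → f w ≈ g w) → sumTail m f ≈ sumTail m g
  sumTail-cong zero    e = e []
  sumTail-cong (suc m) e = +-cong (sumNo1-cong m (e ∘ (0F ∷_)))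
    (+-cong (sumTail-cong m (e ∘ (1F ∷_))) (sumTail-cong m (e ∘ (2F ∷_))))

  sumNo1-*ˡ : ∀ m k f → sumNo1 m (λ w → k * f w) ≈ k * sumNo1 m f
  sumNo1-*ˡ zero    k f = refl
  sumNo1-*ˡ (suc m) k f = trans (+-cong (sumNo1-*ˡ m k _) (sumNo1-*ˡ m k _)) (sym (distribˡ k _ _))

  sumTail-*ˡ : ∀ m k f → sumTail m (λ w → k * f w) ≈ k * sumTail m f
  sumTail-*ˡ zero    k f = refl
  sumTail-*ˡ (suc m) k f = trans
    (+-cong (sumNo1-*ˡ m k _) (trans (+-cong (sumTail-*ˡ m k _) (sumTail-*ˡ m k _)) (sym (distribˡ k _ _))))
    (sym (distribˡ k _ _))

  sumNo1-zero : ∀ m → sumNo1 m (λ _ → 0#) ≈ 0#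
  sumNo1-zero zero    = refl
  sumNo1-zero (suc m) = trans (+-cong (sumNo1-zero m) (sumNo1-zero m)) (+-identityˡ 0#)

  sumTail-zero : ∀ m → sumTail m (λ _ → 0#) ≈ 0#
  sumTail-zero zero    = refl
  sumTail-zero (suc m) = trans (+-cong (sumNo1-zero m) (trans (+-cong (sumTail-zero m) (sumTail-zero m)) (+-identityˡ 0#))) (+-identityˡ 0#)

  sumNo1-+ : ∀ m f g → sumNo1 m (λ w → f w + g w) ≈ sumNo1 m f + sumNo1 m g
  sumNo1-+ zero    f g = refl
  sumNo1-+ (suc m) f g = trans (+-cong (sumNo1-+ m _ _) (sumNo1-+ m _ _))
    (S.solve 4 (λ a b c d → (a :+ b) :+ (c :+ d) := (a :+ c) :+ (b :+ d)) refl _ _ _ _)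

  -- Weighted sums over words.

  weight : ∀ {m} → Carrier → Carrier → Word m → Carrier
  weight p q []       = 1#
  weight p q (0F ∷ w) = q * weight p q w
  weight p q (1F ∷ w) = q * weight p q w
  weight p q (2F ∷ w) = p * weight p q w

  -- One more than the number of entries of w other than 2, that is, the number
  -- of words 1 ∷ w′ in Tri with the same positions of the entry 2 as in 0 ∷ w.

  choices : ∀ {m} → Word m → Carrier
  choices []       = 1#
  choices (0F ∷ w) = 1# + choices w
  choices (1F ∷ w) = 1# + choices w
  choices (2F ∷ w) = choices w

  module _ {p q : Carrier} where

    private
      W : ∀ {m} → Word m → Carrier
      W = weight p q

    -- Condition and weight depend on `w′` only through its 2s. A given set of 2s belongs to one
    -- word `w′` with `No1` and to `choices w′` words with `Tail`, so the latter are collected over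
    -- the former.
    sumTail-⊆₂ : ∀ {m} (w : Word m) →
      sumTail m (λ w′ → χ (w ⊆₂? w′) (W w′)) ≈ sumNo1 m (λ w′ → χ (w ⊆₂? w′) (choices w′ * W w′))
    sumTail-⊆₂ [] = sym (*-identityˡ 1#)
    sumTail-⊆₂ {suc m} (a ∷ w) = step a
      where
      A B C : Carrier
      A = sumNo1 m (λ w′ → χ (w ⊆₂? w′) (W w′))
      B = sumTail m (λ w′ → χ (w ⊆₂? w′) (W w′))
      C = sumNo1 m (λ w′ → χ (w ⊆₂? w′) (choices w′ * W w′))

      B≈C : B ≈ C
      B≈C = sumTail-⊆₂ w

      pullA : ∀ k → sumNo1 m (λ w′ → χ (w ⊆₂? w′) (k * W w′)) ≈ k * A
      pullA k = trans (sumNo1-cong m λ w′ → χ-*ˡ (w ⊆₂? w′) k _) (sumNo1-*ˡ m k _)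

      pullB : ∀ k → sumTail m (λ w′ → χ (w ⊆₂? w′) (k * W w′)) ≈ k * B
      pullB k = trans (sumTail-cong m λ w′ → χ-*ˡ (w ⊆₂? w′) k _) (sumTail-*ˡ m k _)

      pullC : ∀ k → sumNo1 m (λ w′ → χ (w ⊆₂? w′) (choices w′ * (k * W w′))) ≈ k * C
      pullC k = trans (sumNo1-cong m λ w′ → trans
          (χ-cong (w ⊆₂? w′) λ _ → S.solve 3 (λ c k v → c :* (k :* v) := k :* (c :* v)) refl (choices w′) k (W w′))
          (χ-*ˡ (w ⊆₂? w′) k _)) (sumNo1-*ˡ m k _)

      pullAC : sumNo1 m (λ w′ → χ (w ⊆₂? w′) ((1# + choices w′) * (q * W w′))) ≈ q * A + q * C
      pullAC = trans (sumNo1-cong m λ w′ → trans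
          (χ-cong (w ⊆₂? w′) λ _ → trans (distribʳ _ _ _) (+-congʳ (*-identityˡ _)))
          (χ-+ (w ⊆₂? w′) _ _)) (trans (sumNo1-+ m _ _) (+-cong (pullA q) (pullC q)))

      -- An entry of `w` other than 2 imposes nothing. On the left the entries 0 and 1 give `q * A`
      -- and `q * B`; on the right these are the two parts of `1# + choices w′`, as `B ≈ C`.
      free : sumNo1 m (λ w′ → χ (w ⊆₂? w′) (q * W w′))
           + (sumTail m (λ w′ → χ (w ⊆₂? w′) (q * W w′)) + sumTail m (λ w′ → χ (w ⊆₂? w′) (p * W w′)))
           ≈ sumNo1 m (λ w′ → χ (w ⊆₂? w′) ((1# + choices w′) * (q * W w′)))
           + sumNo1 m (λ w′ → χ (w ⊆₂? w′) (choices w′ * (p * W w′)))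
      free = begin
        _                               ≈⟨ +-cong (pullA q) (+-cong (pullB q) (pullB p)) ⟩
        q * A + (q * B + p * B)         ≈⟨ +-congˡ (+-cong (*-congˡ B≈C) (*-congˡ B≈C)) ⟩
        q * A + (q * C + p * C)         ≈⟨ +-assoc _ _ _ ⟨
        (q * A + q * C) + p * C         ≈⟨ +-cong pullAC (pullC p) ⟨
        _                               ∎

      step : ∀ a → sumTail (suc m) (λ w′ → χ ((a ∷ w) ⊆₂? w′) (W w′))
                 ≈ sumNo1 (suc m) (λ w′ → χ ((a ∷ w) ⊆₂? w′) (choices w′ * W w′))
      step 0F = free
      step 1F = free
      step 2F = begin
        sumNo1 m (λ _ → 0#) + (sumTail m (λ _ → 0#) + sumTail m (λ w′ → χ (w ⊆₂? w′) (p * W w′)))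
          ≈⟨ +-cong (sumNo1-zero m) (trans (+-cong (sumTail-zero m) (pullB p)) (+-identityˡ _)) ⟩
        0# + p * B
          ≈⟨ +-cong (sumNo1-zero m) (trans (pullC p) (*-congˡ (sym B≈C))) ⟨
        sumNo1 m (λ _ → 0#) + sumNo1 m (λ w′ → χ (w ⊆₂? w′) (choices w′ * (p * W w′))) ∎

    -- The case of `sumTail-⊆₂` for the all-0 word, whose condition always holds.
    sumTail-weight : ∀ m → sumTail m W ≈ sumNo1 m (λ w → choices w * W w)
    sumTail-weight m = begin
      sumTail m W
        ≈⟨ sumTail-cong m (λ w → χ-true (zeros ⊆₂? w) (twos≡0⇒⊆₂ (twos-zeros m))) ⟨
      sumTail m (λ w → χ (zeros ⊆₂? w) (W w))
        ≈⟨ sumTail-⊆₂ zeros ⟩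
      sumNo1 m (λ w → χ (zeros ⊆₂? w) (choices w * W w))
        ≈⟨ sumNo1-cong m (λ w → χ-true (zeros ⊆₂? w) (twos≡0⇒⊆₂ (twos-zeros m))) ⟩
      sumNo1 m (λ w → choices w * W w) ∎
      where
      zeros : Word m
      zeros = replicate m 0F
      twos-zeros : ∀ m → twos (replicate m 0F) ≡ 0
      twos-zeros zero    = ≡.refl
      twos-zeros (suc m) = twos-zeros m

    -- Every position is independently 0 with weight `q` or 2 with weight `p`.
    sumNo1-weight : ∀ m → sumNo1 m W ≈ (p + q) ^ m
    sumNo1-weight zero    = refl
    sumNo1-weight (suc m) = begin
      sumNo1 m (λ w → q * W w) + sumNo1 m (λ w → p * W w) ≈⟨ +-cong (sumNo1-*ˡ m q _) (sumNo1-*ˡ m p _) ⟩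
      q * sumNo1 m W + p * sumNo1 m W                     ≈⟨ distribʳ _ _ _ ⟨
      (q + p) * sumNo1 m W                                ≈⟨ *-cong (+-comm q p) (sumNo1-weight m) ⟩
      (p + q) * (p + q) ^ m                               ∎

    sumTail-weight-suc : ∀ m → sumTail (suc m) W ≈ q * (p + q) ^ m + (p + q) * sumTail m W
    sumTail-weight-suc m = +-cong (trans (sumNo1-*ˡ m q _) (*-congˡ (sumNo1-weight m)))
      (trans (+-cong (sumTail-*ˡ m q _) (sumTail-*ˡ m p _))
        (trans (sym (distribʳ _ _ _)) (*-congʳ (+-comm q p))))

    -- Solves the recurrence of `sumTail-weight-suc`, with initial value 1 at length 0. Starting at
    -- length `suc m` avoids the exponent -1.
    sumTail-weight-closed : ∀ m → sumTail (suc m) W ≈ (p + q) ^ m * ((p + q) + suc m ×ℕ q)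
    sumTail-weight-closed zero = trans (sumTail-weight-suc 0)
      (S.solve 2 (λ p q → q :* S.con 1 :+ (p :+ q) :* S.con 1 := S.con 1 :* ((p :+ q) :+ (q :+ S.con 0))) refl p q)
    sumTail-weight-closed (suc m) = trans (sumTail-weight-suc (suc m)) (trans (+-congˡ (*-congˡ (sumTail-weight-closed m)))
      (S.solve 4 (λ q s c k → q :* (s :* c) :+ s :* (c :* (s :+ k)) := (s :* c) :* (s :+ (q :+ k)))
        refl q (p + q) ((p + q) ^ m) (suc m ×ℕ q)))

    module _ (p+q≈1 : p + q ≈ 1#) where

      private
        merge : ∀ {a b k} → a ≈ q * k → b ≈ p * k → a + b ≈ k
        merge {k = k} a≈ b≈ = trans (+-cong a≈ b≈) (trans (sym (distribʳ k q p))
          (trans (*-congʳ (trans (+-comm q p) p+q≈1)) (*-identityˡ k)))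

      -- A 2 of `w` forces the factor `p`; any other position contributes `q + p`, which is 1.
      sumNo1-⊆₂ : ∀ {m} (w : Word m) → No1 w → sumNo1 m (λ w′ → χ (w ⊆₂? w′) (W w′)) ≈ p ^ twos w
      sumNo1-⊆₂ []               _ = refl
      sumNo1-⊆₂ {suc m} (a ∷ w) n = step a n
        where
        pullA : ∀ k → No1 w → sumNo1 m (λ w′ → χ (w ⊆₂? w′) (k * W w′)) ≈ k * p ^ twos w
        pullA k n = trans (sumNo1-cong m λ w′ → χ-*ˡ (w ⊆₂? w′) k _) (trans (sumNo1-*ˡ m k _) (*-congˡ (sumNo1-⊆₂ w n)))
        step : ∀ a → No1 (a ∷ w) → sumNo1 (suc m) (λ w′ → χ ((a ∷ w) ⊆₂? w′) (W w′)) ≈ p ^ twos (a ∷ w)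
        step 0F n = merge (pullA q n) (pullA p n)
        step 2F n = trans (+-cong (sumNo1-zero m) (pullA p n)) (+-identityˡ _)

      sumNo1-⊴ : ∀ {m} (w : Word m) → No1 w → sumNo1 m (λ w′ → χ (w ⊴? w′) (W w′)) ≈ p ^ twos w
      sumNo1-⊴ []               _ = refl
      sumNo1-⊴ {suc m} (a ∷ w) n = step a n
        where
        pullA : ∀ k → No1 w → sumNo1 m (λ w′ → χ (w ⊴? w′) (k * W w′)) ≈ k * p ^ twos w
        pullA k n = trans (sumNo1-cong m λ w′ → χ-*ˡ (w ⊴? w′) k _) (trans (sumNo1-*ˡ m k _) (*-congˡ (sumNo1-⊴ w n)))
        step : ∀ a → No1 (a ∷ w) → sumNo1 (suc m) (λ w′ → χ ((a ∷ w) ⊴? w′) (W w′)) ≈ p ^ twos (a ∷ w)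
        step 0F n = merge (pullA q n) (pullA p n)
        step 2F n = trans (+-cong (sumNo1-zero m) (pullA p n)) (+-identityˡ _)

      sumTail-⊴ : ∀ {m} (w : Word m) → Tail w → sumTail m (λ w′ → χ (w ⊴? w′) (W w′)) ≈ p ^ twos w
      sumTail-⊴ []               _ = refl
      sumTail-⊴ {suc m} (a ∷ w) t = step a t
        where
        pullA : ∀ k → No1 w → sumNo1 m (λ w′ → χ (w ⊴? w′) (k * W w′)) ≈ k * p ^ twos w
        pullA k n = trans (sumNo1-cong m λ w′ → χ-*ˡ (w ⊴? w′) k _) (trans (sumNo1-*ˡ m k _) (*-congˡ (sumNo1-⊴ w n)))
        pullB : ∀ k → Tail w → sumTail m (λ w′ → χ (w ⊴? w′) (k * W w′)) ≈ k * p ^ twos w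
        pullB k t = trans (sumTail-cong m λ w′ → χ-*ˡ (w ⊴? w′) k _) (trans (sumTail-*ˡ m k _) (*-congˡ (sumTail-⊴ w t)))
        step : ∀ a → Tail (a ∷ w) → sumTail (suc m) (λ w′ → χ ((a ∷ w) ⊴? w′) (W w′)) ≈ p ^ twos (a ∷ w)
        -- Where a 0 of `w` is extended to 2, the rest of `w′` still ranges over `Tail`, so `No1 w`
        -- is weakened to `Tail w`.
        step 0F n = merge (pullA q n) (trans (+-cong (sumTail-zero m) (pullB p (No1⇒Tail w n))) (+-identityˡ _))
        step 1F t = trans (+-cong (sumNo1-zero m) refl) (trans (+-identityˡ _) (merge (pullB q t) (pullB p t)))
        step 2F t = trans (+-cong (sumNo1-zero m) (trans (+-cong (sumTail-zero m) (pullB p t)) (+-identityˡ _))) (+-identityˡ _)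

  module _ {p q : Carrier} where

    -- Each 2 absorbs one factor `s`. The parameter `p` of the weight is thus `t` before this step
    -- and `s * t` after it.
    weight-scale : ∀ {m} s (w : Word m) → s ^ twos w * weight p q w ≈ weight (s * p) q w
    weight-scale s []       = *-identityˡ 1#
    weight-scale s (0F ∷ w) = trans
      (S.solve 3 (λ a q b → a :* (q :* b) := q :* (a :* b)) refl (s ^ twos w) q (weight p q w))
      (*-congˡ (weight-scale s w))
    weight-scale s (1F ∷ w) = trans
      (S.solve 3 (λ a q b → a :* (q :* b) := q :* (a :* b)) refl (s ^ twos w) q (weight p q w))
      (*-congˡ (weight-scale s w))
    weight-scale s (2F ∷ w) = trans
      (S.solve 4 (λ s a p b → (s :* a) :* (p :* b) := (s :* p) :* (a :* b)) refl s (s ^ twos w) p (weight p q w))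
      (*-congˡ (weight-scale s w))

  -- The M-triangle in closed form.

  module MTriangle {m : ℕ} {rk : Tri (suc m) → ℕ} (isRank : CoreLabelOrder.IsRank (Hoch (suc m)) rk)
    {μ : Tri (suc m) → Tri (suc m) → ℤ} (isMöbius : CoreLabelOrder.IsMöbius (Hoch (suc m)) μ) where

    open CoreLabelOrder (Hoch (suc m)) using (_⊑?_; _⊑_)
    open FiniteLattice (Hoch (suc m)) using (elements; complete; unique; _≟_)

    -- `Triangles.M` over an arbitrary field; at `ℚ⟮x,y⟯` the two agree by computation.
    M : Carrier → Carrier → Carrier
    M s t = ∑ elements λ u → ∑ elements λ v → μ u v · (s ^ rk u * t ^ rk v)

    module _ {s t q : Carrier} (t+q≈1 : t + q ≈ 1#) where

      private
        W : Word m → Carrier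
        W = weight t q

      -- The function g of the introduction, with W written as weight t q.

      transform : Word (suc m) → Carrier
      transform (0F ∷ w) = W w + - t * (choices w * W w)
      transform (1F ∷ w) = t * W w
      transform (2F ∷ w) = 0#

      private
        χ-⊑ : ∀ u v {a} → χ (u ⊑? v) a ≈ χ (value u ⊑ʷ? value v) a
        χ-⊑ u v = χ-⇔ (u ⊑? v) (value u ⊑ʷ? value v)
          (mk⇔ (λ u⊑v → ⊑⇒⊑ʷ {u = u} {v} (λ {j} → u⊑v {j})) (λ u⊑v {j} → ⊑ʷ⇒⊑ {u = u} {v} u⊑v {j}))

        -- Above `0F ∷ w` the words beginning with 1 contribute `t * B`; the term with `- t` is
        -- chosen to cancel this by `sumTail-⊆₂`, leaving `t ^ twos w`. Above `1F ∷ w` lie only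
        -- words beginning with 1.
        ∑-transformʷ : ∀ u → IsTriword u →
          sumNo1 m (λ w → χ (u ⊑ʷ? (0F ∷ w)) (transform (0F ∷ w)))
          + sumTail m (λ w → χ (u ⊑ʷ? (1F ∷ w)) (transform (1F ∷ w))) ≈ t ^ rank u
        ∑-transformʷ (0F ∷ w) tri = begin
          sumNo1 m (λ w′ → χ (w ⊆₂? w′) (W w′ + - t * (choices w′ * W w′)))
          + sumTail m (λ w′ → χ (w ⊆₂? w′) (t * W w′))
            ≈⟨ +-cong (trans (sumNo1-cong m λ w′ → trans (χ-+ (w ⊆₂? w′) _ _) (+-congˡ (χ-*ˡ (w ⊆₂? w′) (- t) _)))
                        (trans (sumNo1-+ m _ _) (+-congˡ (sumNo1-*ˡ m (- t) _))))
                      (trans (sumTail-cong m λ w′ → χ-*ˡ (w ⊆₂? w′) t _) (sumTail-*ˡ m t _)) ⟩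
          (A + - t * C) + t * B
            ≈⟨ +-congˡ (*-congˡ (sumTail-⊆₂ w)) ⟩
          (A + - t * C) + t * C
            ≈⟨ trans (+-assoc _ _ _) (+-congˡ (trans (sym (distribʳ C (- t) t)) (trans (*-congʳ (-‿inverseˡ t)) (zeroˡ C)))) ⟩
          A + 0#
            ≈⟨ trans (+-identityʳ A) (sumNo1-⊆₂ t+q≈1 w (Equivalence.to 0∷-triword tri)) ⟩
          t ^ twos w ∎
          where
          A B C : Carrier
          A = sumNo1 m (λ w′ → χ (w ⊆₂? w′) (W w′))
          B = sumTail m (λ w′ → χ (w ⊆₂? w′) (W w′))
          C = sumNo1 m (λ w′ → χ (w ⊆₂? w′) (choices w′ * W w′))
        ∑-transformʷ (1F ∷ w) tri = trans (+-cong (sumNo1-zero m)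
            (trans (sumTail-cong m λ w′ → χ-*ˡ (w ⊴? w′) t _) (trans (sumTail-*ˡ m t _)
              (*-congˡ (sumTail-⊴ t+q≈1 w (Equivalence.to 1∷-triword tri))))))
          (+-identityˡ _)
        ∑-transformʷ (2F ∷ w) tri = contradiction ≡.refl (IsTriword.first≢2 tri zero ≡.refl)

        ∑-transform : ∀ u → ∑ elements (λ v → χ (u ⊑? v) (transform (value v))) ≈ t ^ rk u
        ∑-transform u = begin
          ∑ elements (λ v → χ (u ⊑? v) (transform (value v)))
            ≈⟨ ∑-cong elements (λ v → χ-⊑ u v) ⟩
          ∑ elements (λ v → χ (value u ⊑ʷ? value v) (transform (value v)))
            ≈⟨ ∑-Tri m (λ v → χ (value u ⊑ʷ? v) (transform v)) ⟩
          sumNo1 m _ + sumTail m _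
            ≈⟨ ∑-transformʷ (value u) (isTriword u) ⟩
          t ^ rank (value u)
            ≡⟨ ≡.cong (t ^_) (rk≡rank isRank u) ⟨
          t ^ rk u ∎

        open MöbiusInversion elements _≟_ unique complete _⊑?_
          (λ {u} {j} p → p) (λ {u} {v} {w} u⊑v v⊑w {j} p → v⊑w {j} (u⊑v {j} p))
          (λ {u} {v} u⊑v v⊑u → ⊑-antisym {u = u} {v} (λ {j} → u⊑v {j}) (λ {j} → v⊑u {j})) isMöbius

        σ : Carrier
        σ = s * t + q

      -- `s ^ rk u` comes out of the inner sum, and inversion turns the rest into `transform`.
      M-transform : M s t ≈ ∑ elements (λ u → s ^ rank (value u) * transform (value u))
      M-transform = ∑-cong elements λ u → begin
        ∑ elements (λ v → μ u v · (s ^ rk u * t ^ rk v))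
          ≈⟨ ∑-cong elements (λ v → trans (·-1-* (μ u v) _)
               (S.solve 3 (λ a b c → a :* (b :* c) := b :* (a :* c)) refl (μ u v · 1#) (s ^ rk u) (t ^ rk v))) ⟩
        ∑ elements (λ v → s ^ rk u * ((μ u v · 1#) * t ^ rk v))
          ≈⟨ ∑-*ˡ elements (s ^ rk u) _ ⟩
        s ^ rk u * ∑ elements (λ v → (μ u v · 1#) * t ^ rk v)
          ≈⟨ *-cong (reflexive (≡.cong (s ^_) (rk≡rank isRank u))) (inversion ∑-transform u) ⟩
        s ^ rank (value u) * transform (value u) ∎

      -- After `weight-scale`, the `choices` sum is by `sumTail-weight` again a sum over `Tail`, so
      -- both tail contributions combine with coefficient `s * t - t`.
      M-weights : M s t ≈ σ ^ m + (s * t - t) * sumTail m (weight (s * t) q)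
      M-weights = begin
        M s t
          ≈⟨ M-transform ⟩
        ∑ elements (λ u → s ^ rank (value u) * transform (value u))
          ≈⟨ ∑-Tri m (λ u → s ^ rank u * transform u) ⟩
        sumNo1 m (λ w → s ^ twos w * (W w + - t * (choices w * W w))) + sumTail m (λ w → (s * s ^ twos w) * (t * W w))
          ≈⟨ +-cong (sumNo1-cong m λ w → trans
               (S.solve 4 (λ a b c d → a :* (b :+ c :* (d :* b)) := (a :* b) :+ c :* (d :* (a :* b))) refl (s ^ twos w) (W w) (- t) (choices w))
               (+-cong (weight-scale s w) (*-congˡ (*-congˡ (weight-scale s w)))))
             (sumTail-cong m λ w → trans
               (S.solve 4 (λ s a t b → (s :* a) :* (t :* b) := (s :* t) :* (a :* b)) refl s (s ^ twos w) t (W w))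
               (*-congˡ (weight-scale s w))) ⟩
        sumNo1 m (λ w → V w + - t * (choices w * V w)) + sumTail m (λ w → (s * t) * V w)
          ≈⟨ +-cong (trans (sumNo1-+ m _ _) (+-cong (sumNo1-weight m) (trans (sumNo1-*ˡ m (- t) _) (*-congˡ (sym (sumTail-weight m))))))
                    (sumTail-*ˡ m (s * t) _) ⟩
        (σ ^ m + - t * sumTail m V) + (s * t) * sumTail m V
          ≈⟨ S.solve 4 (λ a b c d → (a :+ b :* d) :+ c :* d := a :+ (c :+ b) :* d) refl (σ ^ m) (- t) (s * t) (sumTail m V) ⟩
        σ ^ m + (s * t - t) * sumTail m V ∎
        where
        V : Word m → Carrier
        V = weight (s * t) q

      private
        1+δ≈σ : 1# + (s * t - t) ≈ σ
        1+δ≈σ = begin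
          1# + (s * t - t)        ≈⟨ +-congʳ t+q≈1 ⟨
          (t + q) + (s * t - t)   ≈⟨ S.solve 4 (λ t q a b → (t :+ q) :+ (a :+ b) := (t :+ b) :+ (a :+ q)) refl t q (s * t) (- t) ⟩
          (t - t) + σ             ≈⟨ trans (+-congʳ (-‿inverseʳ t)) (+-identityˡ σ) ⟩
          σ                       ∎

      -- Here `m` is n - 1, so `k` is the exponent n - 2; `1# + δ ≈ σ` turns `σ * (1# + δ)` into a
      -- square.
      M-suc : ∀ k → m ≡ suc k → M s t ≈ σ ^ k * (σ * σ + (m ×ℕ 1#) * (q * (s * t - t)))
      M-suc k ≡.refl = begin
        M s t
          ≈⟨ M-weights ⟩
        σ * σ ^ k + δ * sumTail (suc k) (weight (s * t) q)
          ≈⟨ +-congˡ (*-congˡ (trans (sumTail-weight-closed k) (*-congˡ (+-congˡ m×q)))) ⟩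
        σ * σ ^ k + δ * (σ ^ k * (σ + (m ×ℕ 1#) * q))
          ≈⟨ S.solve 5 (λ a c d n q → a :* c :+ d :* (c :* (a :+ n :* q)) := c :* (a :* (S.con 1 :+ d) :+ n :* (q :* d)))
               refl σ (σ ^ k) δ (m ×ℕ 1#) q ⟩
        σ ^ k * (σ * (1# + δ) + (m ×ℕ 1#) * (q * δ))
          ≈⟨ *-congˡ (+-congʳ (*-congˡ 1+δ≈σ)) ⟩
        σ ^ k * (σ * σ + (m ×ℕ 1#) * (q * δ)) ∎
        where
        δ : Carrier
        δ = s * t - t
        m×q : m ×ℕ q ≈ (m ×ℕ 1#) * q
        m×q = trans (×-congʳ m (sym (*-identityˡ q))) (sym (×-assoc-* m 1# q))

      M-zero : m ≡ 0 → M s t ≈ σ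
      M-zero ≡.refl = trans M-weights (trans (+-congˡ (*-identityʳ _)) 1+δ≈σ)

    -- T, U, Q, B and Z are Y times t, s t, 1 − t, s t − t and s t + (1 − t),
    -- with the relations among them stated so that no subtraction occurs.

    M-scaled : ∀ {s t Y T U Q B Z} → Y * t ≈ T → Y * (s * t) ≈ U → T + Q ≈ Y → T + B ≈ U → U + Q ≈ Z → (Z#0 : Z # 0#) →
               Y ^ suc m * M s t ≈ Z ⟨ Z#0 ⟩^ (+ suc m ℤ.- + 2) * (Z * Z + (m ×ℕ 1#) * (Q * B))
    M-scaled {s} {t} {Y} {T} {U} {Q} {B} {Z} Yt≈T Yst≈U T+Q≈Y T+B≈U U+Q≈Z Z#0 = scaled m ≡.refl
      where
      q : Carrier
      q = 1# - t
      t+q≈1 : t + q ≈ 1#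
      t+q≈1 = trans (+-comm t q) (trans (+-assoc 1# (- t) t) (trans (+-congˡ (-‿inverseˡ t)) (+-identityʳ 1#)))
      cancel : ∀ {a b c} → a + b ≈ c → c - a ≈ b
      cancel {a} {b} {c} a+b≈c = trans (+-congʳ (sym a+b≈c)) (trans
        (S.solve 3 (λ a b c → (a :+ b) :+ c := b :+ (a :+ c)) refl a b (- a)) (trans (+-congˡ (-‿inverseʳ a)) (+-identityʳ b)))
      Y-minus : ∀ a → Y * (a - t) ≈ Y * a - T
      Y-minus a = trans (distribˡ Y a (- t)) (+-congˡ (trans (sym (-‿distribʳ-* Y t)) (-‿cong Yt≈T)))
      Yq≈Q : Y * q ≈ Q
      Yq≈Q = trans (Y-minus 1#) (trans (+-congʳ (*-identityʳ Y)) (cancel T+Q≈Y))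
      Yδ≈B : Y * (s * t - t) ≈ B
      Yδ≈B = trans (Y-minus (s * t)) (trans (+-congʳ Yst≈U) (cancel T+B≈U))
      Yσ≈Z : Y * (s * t + q) ≈ Z
      Yσ≈Z = trans (distribˡ Y (s * t) q) (trans (+-cong Yst≈U Yq≈Q) U+Q≈Z)

      scaled : ∀ k → m ≡ k → Y ^ suc m * M s t ≈ Z ⟨ Z#0 ⟩^ (+ suc m ℤ.- + 2) * (Z * Z + (m ×ℕ 1#) * (Q * B))
      -- For n = 1 the exponent is -1: one of the two factors `Z` cancels, and the second summand
      -- has coefficient 0.
      scaled zero ≡.refl = begin
        (Y * 1#) * M s t
          ≈⟨ trans (*-cong (*-identityʳ Y) (M-zero t+q≈1 ≡.refl)) Yσ≈Z ⟩
        Z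
          ≈⟨ trans (*-congʳ (inverseˡ Z#0)) (*-identityˡ Z) ⟨
        (Z ⁻¹⟨ Z#0 ⟩ * Z) * Z
          ≈⟨ S.solve 3 (λ i z x → (i :* S.con 1) :* (z :* z :+ S.con 0 :* x) := (i :* z) :* z) refl (Z ⁻¹⟨ Z#0 ⟩) Z (Q * B) ⟨
        (Z ⁻¹⟨ Z#0 ⟩ * 1#) * (Z * Z + 0# * (Q * B)) ∎
      scaled (suc k) ≡.refl = begin
        (Y * (Y * Y ^ k)) * M s t
          ≈⟨ *-congˡ (M-suc t+q≈1 k ≡.refl) ⟩
        (Y * (Y * Y ^ k)) * (σ ^ k * (σ * σ + N * (q * δ)))
          -- Of the `k + 2` factors `Y`, `k` go with `σ ^ k` and two clear the denominators of each
          -- quadratic term.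
          ≈⟨ S.solve 7 (λ y yk sk s n q d → (y :* (y :* yk)) :* (sk :* (s :* s :+ n :* (q :* d)))
                := (yk :* sk) :* ((y :* s) :* (y :* s) :+ n :* ((y :* q) :* (y :* d)))) refl Y (Y ^ k) (σ ^ k) σ N q δ ⟩
        (Y ^ k * σ ^ k) * ((Y * σ) * (Y * σ) + N * ((Y * q) * (Y * δ)))
          ≈⟨ *-cong (trans (sym (^-distrib-* Y σ k)) (^-congˡ k Yσ≈Z))
               (+-cong (*-cong Yσ≈Z Yσ≈Z) (*-congˡ (*-cong Yq≈Q Yδ≈B))) ⟩
        Z ^ k * (Z * Z + N * (Q * B)) ∎
        where
        σ δ N : Carrier
        σ = s * t + q
        δ = s * t - t
        N = m ×ℕ 1#

    -- The substitutions that give the F- and H-triangles.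

    module _ (x y : Carrier) where

      -- `M-scaled` with Y = y, t = (y - x)/y and st = (y + 1)/y, so that Q = x, B = x + 1 and Z = x
      -- + y + 1.
      F-triangle : (y-x#0 : (y - x) # 0#) (y#0 : y # 0#) (x+y+1#0 : (x + y + 1#) # 0#) →
        y ^ suc m * M ((y + 1#) / (y - x) ⟨ y-x#0 ⟩) ((y - x) / y ⟨ y#0 ⟩) ≈
        (x + y + 1#) ⟨ x+y+1#0 ⟩^ (+ suc m ℤ.- + 2)
          * ((+ suc m) · (x ^ 2) + (+ 2) · (x * y) + (+ suc m ℤ.+ + 1) · x + (y + 1#) ^ 2)
      F-triangle y-x#0 y#0 x+y+1#0 = trans
        (M-scaled {T = y - x} {y + 1#} {x} {x + 1#} (cancel-/ y#0)
          (trans (S.solve 5 (λ y a d b e → y :* ((a :* d) :* (b :* e)) := a :* ((d :* b) :* (y :* e))) refl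
                   y (y + 1#) ((y - x) ⁻¹⟨ y-x#0 ⟩) (y - x) (y ⁻¹⟨ y#0 ⟩))
             (trans (*-congˡ (trans (*-cong (inverseˡ y-x#0) (inverseʳ y#0)) (*-identityˡ 1#))) (*-identityʳ _)))
          (minus-plus y x)
          (trans (S.solve 4 (λ y x n o → (y :+ n) :+ (x :+ o) := ((y :+ n) :+ x) :+ o) refl y x (- x) 1#) (+-congʳ (minus-plus y x)))
          (S.solve 3 (λ x y o → (y :+ o) :+ x := (x :+ y) :+ o) refl x y 1#) x+y+1#0)
        (*-congˡ (sym poly))
        where
        κ : Carrier
        κ = m ×ℕ 1#
        -- With `κ` = n - 1, the quadratic factor is regrouped in the shape Z * Z + κ * (Q * B)
        -- delivered by `M-scaled`.
        poly : (+ suc m) · (x ^ 2) + (+ 2) · (x * y) + (+ suc m ℤ.+ + 1) · x + (y + 1#) ^ 2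
             ≈ (x + y + 1#) * (x + y + 1#) + κ * (x * (x + 1#))
        poly = trans
          (+-congʳ (+-cong (+-congʳ (+-congˡ (·-1-* (+ m) (x ^ 2))))
            (+-congˡ (trans (×-homo-+ x m 1) (+-congʳ (·-1-* (+ m) x))))))
          (S.solve 3 (λ x y k → ((((x :* (x :* S.con 1) :+ k :* (x :* (x :* S.con 1))) :+ (x :* y :+ (x :* y :+ S.con 0)))
                :+ (x :+ (k :* x :+ (x :+ S.con 0)))) :+ (y :+ S.con 1) :* ((y :+ S.con 1) :* S.con 1))
              := ((x :+ y) :+ S.con 1) :* ((x :+ y) :+ S.con 1) :+ k :* (x :* (x :+ S.con 1))) refl x y κ)

      -- `M-scaled` with Y = x(y - 1) + 1, whose products with t and st are x(y - 1) and xy; then Q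
      -- = 1, B = x and Z = xy + 1.
      H-triangle : (y-1#0 : (y - 1#) # 0#) (D#0 : (x * (y - 1#) + 1#) # 0#) (xy+1#0 : (x * y + 1#) # 0#) →
        (x * (y - 1#) + 1#) ^ suc m * M (y / (y - 1#) ⟨ y-1#0 ⟩) ((x * (y - 1#)) / (x * (y - 1#) + 1#) ⟨ D#0 ⟩) ≈
        (x * y + 1#) ⟨ xy+1#0 ⟩^ (+ suc m ℤ.- + 2) * ((x * y + 1#) ^ 2 + (+ suc m ℤ.- + 1) · x)
      H-triangle y-1#0 D#0 xy+1#0 = trans
        (M-scaled {T = x * (y - 1#)} {x * y} {1#} {x} (cancel-/ D#0)
          (trans (S.solve 6 (λ D y d x b e → D :* ((y :* d) :* ((x :* b) :* e)) := (x :* y) :* ((d :* b) :* (D :* e))) refl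
                   D y ((y - 1#) ⁻¹⟨ y-1#0 ⟩) x (y - 1#) (D ⁻¹⟨ D#0 ⟩))
             (trans (*-congˡ (trans (*-cong (inverseˡ y-1#0) (inverseʳ D#0)) (*-identityˡ 1#))) (*-identityʳ _)))
          refl
          (trans (+-congˡ (sym (*-identityʳ x))) (trans (sym (distribˡ x _ _)) (*-congˡ (minus-plus y 1#))))
          refl xy+1#0)
        (*-congˡ (sym (+-cong (*-congˡ (*-identityʳ _)) (trans (·-1-* (+ m) x) (*-congˡ (sym (*-identityˡ x)))))))
        where
        D : Carrier
        D = x * (y - 1#) + 1#

-- Specialisation to the field of rational functions in `x` and `y`.

open Defs using
  ( x; y; _≈_; _#_; _+_; _*_; _-_; 0#; 1#; _^_; _·_; _⁻¹⟨_⟩; _/_⟨_⟩; _⟨_⟩^_; ∑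
  ; y#0; y-x#0; y-1#0; x[y-1]+1#0; x+y+1#0; xy+1#0 )

corollary6p7 : (n : ℕ) → 0 ℕ.< n →
    (rk : Tri n → ℕ) → CoreLabelOrder.IsRank (Hoch n) rk →
    (μ : Tri n → Tri n → ℤ) → CoreLabelOrder.IsMöbius (Hoch n) μ →
    (Triangles.F n rk μ ≈
    (x + y + 1#) ⟨ x+y+1#0 ⟩^ (+ n ℤ.- + 2)
    * ((+ n) · (x ^ 2) + (+ 2) · (x * y) + (+ n ℤ.+ + 1) · x + (y + 1#) ^ 2))
    ×
    (Triangles.H n rk μ ≈
    (x * y + 1#) ⟨ xy+1#0 ⟩^ (+ n ℤ.- + 2)
    * ((x * y + 1#) ^ 2 + (+ n ℤ.- + 1) · x))
corollary6p7 (suc m) _ rk isRank μ isMöbius =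
  F-triangle x y y-x#0 y#0 x+y+1#0 , H-triangle x y y-1#0 x[y-1]+1#0 xy+1#0
  where open Sums.MTriangle ℚ⟮x,y⟯-field isRank isMöbius
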